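{- Let $b,s,k>0$ be integers such that $$D=D(b,s,k)=(4bs+1)^k+\bigl(b(4bs+1)^k+s\bigr)^2$$ is squarefree. If $\gcd(b,s)>2$, then $h(D)>1$.
   Context: For a squarefree integer $D>1$, $h(D)$ denotes the class number of the real quadratic field $\mathbb{Q}(\sqrt D)$. -}

module Defs where

open import Data.Fin.Base using (Fin)
open import Data.Integer.Base using (ℤ; +_)
open import Data.List.Base using (List; []; _∷_)
open import Data.List.Relation.Unary.Any using (Any)
open import Data.Nat.Base as ℕ using (ℕ)
open import Data.Nat.Divisibility using (_∣_)
open import Data.Product.Base using (Σ; ∃₂; ∃-syntax; _×_)
open import Data.Rational.Base as ℚ using (ℚ; 0ℚ; 1ℚ)
open import Function.Bundles using (_⇔_)
open import Function.Definitions using (Bijective)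
open import Relation.Binary.PropositionalEquality using (_≡_; _≢_)

Squarefree : ℕ → Set
Squarefree n = ∀ d → d ℕ.* d ∣ n → d ≡ 1

-- The definitions make sense for every D, but K is a quadratic field only
-- when D is not a perfect square (in particular for squarefree D > 1).
module QuadraticField (D : ℕ) where

  -- re +√D im stands for re + im·√D.
  record K : Set where
    constructor _+√D_
    field
      re im : ℚ

  open K public

  Dℚ : ℚ
  Dℚ = + D ℚ./ 1

  infixl 6 _+_
  infixl 7 _*_

  _+_ : K → K → K
  (a +√D b) + (c +√D d) = (a ℚ.+ c) +√D (b ℚ.+ d)

  _*_ : K → K → K
  (a +√D b) * (c +√D d) =
    (a ℚ.* c ℚ.+ Dℚ ℚ.* (b ℚ.* d)) +√D (a ℚ.* d ℚ.+ b ℚ.* c)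

  0K 1K : K
  0K = 0ℚ +√D 0ℚ
  1K = 1ℚ +√D 0ℚ

  fromℤ : ℤ → K
  fromℤ n = (n ℚ./ 1) +√D 0ℚ

  -- The list c₀ , … , cₙ₋₁ encodes the monic polynomial
  -- c₀ + c₁ X + ⋯ + cₙ₋₁ Xⁿ⁻¹ + Xⁿ.
  evalMonic : List ℤ → K → K
  evalMonic []       x = 1K
  evalMonic (c ∷ cs) x = fromℤ c + x * evalMonic cs x

  -- Membership in the ring of integers of K.
  IsIntegral : K → Set
  IsIntegral x = ∃[ cs ] evalMonic cs x ≡ 0K

  -- Membership in the submodule of K generated by a list over the ring of
  -- integers.
  _∈Span_ : K → List K → Set
  x ∈Span []       = x ≡ 0K
  x ∈Span (g ∷ gs) =
    ∃₂ λ a y → IsIntegral a × y ∈Span gs × x ≡ a * g + y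

  -- A fractional ideal is a nonzero finitely generated submodule of K over
  -- the ring of integers; it is represented by a generating list.  Distinct
  -- lists may represent the same ideal, so ideals are only ever compared
  -- through their elements.
  record FractionalIdeal : Set where
    field
      generators : List K
      nonzero    : Any (_≢ 0K) generators

  open FractionalIdeal public

  infix 4 _∈_ _∼_

  _∈_ : K → FractionalIdeal → Set
  x ∈ I = x ∈Span generators I

  -- Equality in the ideal class group: J = c I for some c ∈ K, c ≠ 0.
  _∼_ : FractionalIdeal → FractionalIdeal → Set
  I ∼ J = ∃[ c ] c ≢ 0K × (∀ y → y ∈ J ⇔ (∃[ x ] x ∈ I × y ≡ c * x))

  -- The class number is h: the ideal class group, i.e. the fractional
  -- ideals with _∼_ as equality, is in bijection with a set of h elements.
  IsClassNumber : ℕ → Set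
  IsClassNumber h = Σ (Fin h → FractionalIdeal) (Bijective _≡_ _∼_)

open QuadraticField public using (IsClassNumber)

{-# OPTIONS --safe #-}

-- Put q = 4bs + 1, Q = q^k and m = bQ + s, so that D = Q + m².  The forms
-- (q^i, 2m, −q^(k−i)) with 0 ≤ i ≤ k all have discriminant 4D and form one
-- cycle of equivalent forms (up to sign).  Reducing a representation along this
-- cycle shows that every integer of absolute value below q represented by
-- x² − Dy² is, up to sign, a square.  On the other hand D ≡ 1 modulo gcd(b, s)²,
-- so an odd prime p dividing the gcd splits, and so does p = 2 when 4 divides the
-- gcd.  If the class number were 1, a prime above p would be principal, and
-- clearing denominators in the norm of its generator would make x² − Dy² represent
-- a nonsquare of absolute value at most 4p < q.
module Submission where

open import Defs
open import Data.Empty using (⊥; ⊥-elim)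
open import Data.Fin.Base using (Fin; zero; suc)
open import Data.Integer.Base as ℤ using (ℤ; +_; -[1+_]; 0ℤ; 1ℤ; -1ℤ; ∣_∣)
import Data.Integer.Divisibility.Signed as Signed
import Data.Integer.Properties as ℤ
open import Data.List.Base using (List; []; _∷_; length)
open import Data.List.Relation.Unary.All using (All; []; _∷_)
open import Data.List.Relation.Unary.Any using (here)
open import Data.Nat.Base as ℕ using (ℕ; zero; suc; NonZero; z≤n; s≤s; s≤s⁻¹; >-nonZero; >-nonZero⁻¹)
open import Data.Nat.Coprimality as Coprime using (Coprime; coprime-divisor; 1-coprimeTo)
open import Data.Nat.Divisibility as ∣ using (_∣_; _∤_; divides; quotient)
open import Data.Nat.GCD using (gcd; gcd[m,n]∣m; gcd[m,n]∣n)
open import Data.Nat.ListAction using (product)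
open import Data.Nat.Primality using (Prime; euclidsLemma; prime⇒irreducible; prime⇒nonZero; prime[2]; ¬prime[1])
open import Data.Nat.Primality.Factorisation using (factorise; PrimeFactorisation)
import Data.Nat.Properties as ℕ
import Data.Nat.Tactic.RingSolver as ℕ-Solver
open import Data.Product.Base using (∃-syntax; ∃₂; _×_; _,_; proj₁; proj₂)
open import Data.Rational.Base as ℚ using (ℚ; mkℚ; 0ℚ; 1ℚ; ½; toℚᵘ)
import Data.Rational.Properties as ℚ
open import Data.Rational.Unnormalised.Base as ℚᵘ using (mkℚᵘ; *≡*)
import Data.Rational.Unnormalised.Properties as ℚᵘ
open import Data.Sum.Base using (_⊎_; inj₁; inj₂; reduce)
open import Function.Bundles using (Equivalence)
open import Relation.Binary.PropositionalEquality
open import Relation.Nullary.Decidable using (yes; no; decidable-stable; dec⇒maybe)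
open import Relation.Nullary.Negation using (¬_)
open import Tactic.RingSolver using (solve-∀)
import Tactic.RingSolver.Core.AlmostCommutativeRing as ACR

-- Reduction of the forms of discriminant 4D

-- The number q = 4bs + 1 is what closes the cycle. If AC = Q then m = bAC + s, and substituting y +
-- 2bAx for y turns the coefficient A of x² into A + 4bsA = qA. If C = qC′, substituting x + 2bC′y
-- for x restores the middle coefficient 2m and leaves -C′, so one factor q has moved from C to A.
-- Coordinates are kept nonnegative. A representation either survives both substitutions and gets no
-- larger, or lies in a cone where its value is, up to sign, a sum of nonnegative terms, hence too
-- large or a square. On the ideal side an integral element is a root of an arbitrary monic
-- polynomial, so its shape (t + w√D)/2 has to be derived. Bounded denominators of powers give
-- integral norms, and norms give the trace. A principal prime has a generator with half-integral
-- coordinates. For odd p doubling is harmless: it yields the value cp with c dividing 4, so cp ≤ 4p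
-- ≤ 4b < q, and cp is no square because p does not divide c. For p = 2 the scaling factor would not
-- be prime to p, so the argument runs in ℤ[(1 + √D)/2], and the value is 4 · 2 = 8.

module Reduction where
  open import Data.Nat.Base using (_+_; _*_; _^_; _≤_; _<_; ∣_-_∣)

  m+o≡n⊎m≡n+o : ∀ m n → (∃[ o ] m + o ≡ n) ⊎ (∃[ o ] m ≡ n + o)
  m+o≡n⊎m≡n+o m n with ℕ.≤-total m n
  ... | inj₁ m≤n = inj₁ (ℕ.m≤n⇒∃[o]m+o≡n m≤n)
  ... | inj₂ n≤m with ℕ.m≤n⇒∃[o]m+o≡n n≤m
  ...   | o , eq = inj₂ (o , sym eq)

  -- Stands in for subtraction: an identity between indefinite forms becomes two identities in ℕ
  -- with a common summand `c`.
  ∣-∣-cancel : ∀ c {m n m′ n′} → m ≡ c + m′ → n ≡ c + n′ → ∣ m - n ∣ ≡ ∣ m′ - n′ ∣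
  ∣-∣-cancel c {m′ = m′} {n′} refl refl = ℕ.∣m+n-m+o∣≡∣n-o∣ c m′ n′

  module Form (b s q m : ℕ) (q≡ : q ≡ 4 * b * s + 1) where

    form : ℕ → ℕ → ℕ → ℕ → ℕ
    form A C x y = ∣ A * x * x + 2 * m * x * y - C * y * y ∣

    -- On the cone y ≤ 2bAx the part 2bACxy = Cy(y + z) of the middle term absorbs the negative
    -- square Cy², so only nonnegative terms remain.
    form-cone : ∀ A C x y z → m ≡ b * (A * C) + s → y + z ≡ 2 * b * A * x →
                form A C x y ≡ A * x * x + 2 * s * x * y + C * y * z
    form-cone A C x y z m≡ h = trans
      (∣-∣-cancel (C * y * y) lhs (sym (ℕ.+-identityʳ (C * y * y))))
      (ℕ.∣-∣-identityʳ (A * x * x + 2 * s * x * y + C * y * z))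
      where
      open ≡-Reasoning
      expand : ∀ b s A C x y → A * x * x + 2 * (b * (A * C) + s) * x * y
             ≡ A * x * x + 2 * s * x * y + C * y * (2 * b * A * x)
      expand = ℕ-Solver.solve-∀
      collect : ∀ A C s x y z → A * x * x + 2 * s * x * y + C * y * (y + z)
              ≡ C * y * y + (A * x * x + 2 * s * x * y + C * y * z)
      collect = ℕ-Solver.solve-∀
      lhs : A * x * x + 2 * m * x * y ≡ C * y * y + (A * x * x + 2 * s * x * y + C * y * z)
      lhs = begin
        A * x * x + 2 * m * x * y                              ≡⟨ cong (λ m → A * x * x + 2 * m * x * y) m≡ ⟩
        A * x * x + 2 * (b * (A * C) + s) * x * y              ≡⟨ expand b s A C x y ⟩
        A * x * x + 2 * s * x * y + C * y * (2 * b * A * x)    ≡⟨ cong (λ t → A * x * x + 2 * s * x * y + C * y * t) h ⟨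
        A * x * x + 2 * s * x * y + C * y * (y + z)            ≡⟨ collect A C s x y z ⟩
        C * y * y + (A * x * x + 2 * s * x * y + C * y * z)    ∎

    -- The substitution y ↦ y + 2bAx, followed in form-step by x ↦ x + 2bCy, carries
    -- the form (A, 2m, −qC) to (qA, 2m, −C).
    form-half : ∀ A C x y u v → m ≡ b * (A * (q * C)) + s → u ≡ 2 * b * A * x → v ≡ 2 * b * C * y →
                form A (q * C) x (u + y)
                ≡ ∣ q * A * x * x + 2 * s * x * y - q * A * x * v + 2 * s * y * v + C * y * y ∣
    form-half A C x y u v m≡ u≡ v≡ = ∣-∣-cancel (q * C * u * (u + y)) lhs rhs
      where
      open ≡-Reasoning
      expandˡ : ∀ b s A C x y → A * x * x + 2 * (b * (A * C) + s) * x * y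
              ≡ C * (2 * b * A * x) * y + (A * x * x + 2 * s * x * y)
      expandˡ = ℕ-Solver.solve-∀
      collectˡ : ∀ b s A x y → A * x * x + 2 * s * x * (2 * b * A * x + y)
               ≡ (4 * b * s + 1) * A * x * x + 2 * s * x * y
      collectˡ = ℕ-Solver.solve-∀
      lhs : A * x * x + 2 * m * x * (u + y) ≡ q * C * u * (u + y) + (q * A * x * x + 2 * s * x * y)
      lhs = begin
        A * x * x + 2 * m * x * (u + y)
          ≡⟨ cong (λ m → A * x * x + 2 * m * x * (u + y)) m≡ ⟩
        A * x * x + 2 * (b * (A * (q * C)) + s) * x * (u + y)
          ≡⟨ expandˡ b s A (q * C) x (u + y) ⟩
        q * C * (2 * b * A * x) * (u + y) + (A * x * x + 2 * s * x * (u + y))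
          ≡⟨ cong (λ u′ → q * C * u′ * (u + y) + (A * x * x + 2 * s * x * (u + y))) u≡ ⟨
        q * C * u * (u + y) + (A * x * x + 2 * s * x * (u + y))
          ≡⟨ cong (λ u′ → q * C * u * (u + y) + (A * x * x + 2 * s * x * (u′ + y))) u≡ ⟩
        q * C * u * (u + y) + (A * x * x + 2 * s * x * (2 * b * A * x + y))
          ≡⟨ cong (λ t → q * C * u * (u + y) + t) (collectˡ b s A x y) ⟩
        q * C * u * (u + y) + ((4 * b * s + 1) * A * x * x + 2 * s * x * y)
          ≡⟨ cong (λ q′ → q * C * u * (u + y) + (q′ * A * x * x + 2 * s * x * y)) q≡ ⟨
        q * C * u * (u + y) + (q * A * x * x + 2 * s * x * y) ∎
      expandʳ : ∀ E u y → E * (u + y) * (u + y) ≡ E * u * (u + y) + (E * u * y + E * y * y)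
      expandʳ = ℕ-Solver.solve-∀
      swap : ∀ b A C q x y → q * C * (2 * b * A * x) * y ≡ q * A * x * (2 * b * C * y)
      swap = ℕ-Solver.solve-∀
      collectʳ : ∀ b s C y → (4 * b * s + 1) * C * y * y ≡ 2 * s * y * (2 * b * C * y) + C * y * y
      collectʳ = ℕ-Solver.solve-∀
      middle : q * C * u * y ≡ q * A * x * v
      middle = begin
        q * C * u * y                  ≡⟨ cong (λ u → q * C * u * y) u≡ ⟩
        q * C * (2 * b * A * x) * y    ≡⟨ swap b A C q x y ⟩
        q * A * x * (2 * b * C * y)    ≡⟨ cong (q * A * x *_) v≡ ⟨
        q * A * x * v                  ∎
      last : q * C * y * y ≡ 2 * s * y * v + C * y * y
      last = begin
        q * C * y * y                              ≡⟨ cong (λ q → q * C * y * y) q≡ ⟩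
        (4 * b * s + 1) * C * y * y                ≡⟨ collectʳ b s C y ⟩
        2 * s * y * (2 * b * C * y) + C * y * y    ≡⟨ cong (λ v → 2 * s * y * v + C * y * y) v≡ ⟨
        2 * s * y * v + C * y * y                  ∎
      rhs : q * C * (u + y) * (u + y)
          ≡ q * C * u * (u + y) + (q * A * x * v + 2 * s * y * v + C * y * y)
      rhs = begin
        q * C * (u + y) * (u + y)
          ≡⟨ expandʳ (q * C) u y ⟩
        q * C * u * (u + y) + (q * C * u * y + q * C * y * y)
          ≡⟨ cong (λ t → q * C * u * (u + y) + t) (cong₂ _+_ middle last) ⟩
        q * C * u * (u + y) + (q * A * x * v + (2 * s * y * v + C * y * y))
          ≡⟨ cong (λ t → q * C * u * (u + y) + t) (ℕ.+-assoc (q * A * x * v) (2 * s * y * v) (C * y * y)) ⟨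
        q * C * u * (u + y) + (q * A * x * v + 2 * s * y * v + C * y * y) ∎

    -- The case where the second substitution is blocked by x ≤ 2bCy. The value is then minus an
    -- expression of the shape in `form-cone`, with the roles of the outer coefficients exchanged,
    -- so one estimate serves both cases.
    form-cone′ : ∀ A C x y z u → m ≡ b * (A * (q * C)) + s → u ≡ 2 * b * A * x → z + x ≡ 2 * b * C * y →
                 form A (q * C) x (u + y) ≡ C * y * y + 2 * s * y * z + q * A * z * x
    form-cone′ A C x y z u m≡ u≡ h = trans (form-half A C x y u (z + x) m≡ u≡ h) (∣-∣-cancel
      (q * A * x * x + 2 * s * x * y) (sym (ℕ.+-identityʳ (q * A * x * x + 2 * s * x * y)))
      (identity (q * A) C s x y z))
      where
      identity : ∀ A C s x y z → A * x * (z + x) + 2 * s * y * (z + x) + C * y * y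
               ≡ A * x * x + 2 * s * x * y + (C * y * y + 2 * s * y * z + A * z * x)
      identity = ℕ-Solver.solve-∀

    form-step : ∀ A C x y u v → m ≡ b * (A * (q * C)) + s → u ≡ 2 * b * A * (v + x) → v ≡ 2 * b * C * y →
                form A (q * C) (v + x) (u + y) ≡ form (q * A) C x y
    form-step A C x y u v m≡ u≡ v≡ = trans (form-half A C (v + x) y u v m≡ u≡ v≡)
      (∣-∣-cancel (q * A * (v + x) * v + 2 * s * y * v) lhs refl)
      where
      open ≡-Reasoning
      expand : ∀ A s v x y → A * (v + x) * (v + x) + 2 * s * (v + x) * y
             ≡ A * (v + x) * v + 2 * s * y * v + (A * x * v + A * x * x + 2 * s * x * y)
      expand = ℕ-Solver.solve-∀
      collect : ∀ b s q A C x y → q * A * x * (2 * b * C * y) + q * A * x * x + 2 * s * x * y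
              ≡ q * A * x * x + 2 * (b * (A * (q * C)) + s) * x * y
      collect = ℕ-Solver.solve-∀
      lhs : q * A * (v + x) * (v + x) + 2 * s * (v + x) * y
          ≡ q * A * (v + x) * v + 2 * s * y * v + (q * A * x * x + 2 * m * x * y)
      lhs = trans (expand (q * A) s v x y) (cong (λ t → q * A * (v + x) * v + 2 * s * y * v + t) (begin
        q * A * x * v + q * A * x * x + 2 * s * x * y
          ≡⟨ cong (λ v → q * A * x * v + q * A * x * x + 2 * s * x * y) v≡ ⟩
        q * A * x * (2 * b * C * y) + q * A * x * x + 2 * s * x * y
          ≡⟨ collect b s q A C x y ⟩
        q * A * x * x + 2 * (b * (A * (q * C)) + s) * x * y
          ≡⟨ cong (λ m → q * A * x * x + 2 * m * x * y) m≡ ⟨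
        q * A * x * x + 2 * m * x * y ∎))

    form-turn-cone : ∀ Q x y z → y + z ≡ 2 * m * x → form Q 1 x y ≡ Q * x * x + y * z
    form-turn-cone Q x y z h = trans
      (∣-∣-cancel (1 * y * y)
        (trans (cong (λ t → Q * x * x + t * y) (sym h)) (identity Q x y z))
        (sym (ℕ.+-identityʳ (1 * y * y))))
      (ℕ.∣-∣-identityʳ (Q * x * x + y * z))
      where
      identity : ∀ Q x y z → Q * x * x + (y + z) * y ≡ 1 * y * y + (Q * x * x + y * z)
      identity = ℕ-Solver.solve-∀

    -- At the end of the cycle C = 1 and no factor q is left to move. The substitution by 2mx
    -- instead negates the form and exchanges its variables, which leads back to the first form.
    form-turn : ∀ Q x y u → u ≡ 2 * m * x → form Q 1 x (u + y) ≡ form 1 Q y x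
    form-turn Q x y u u≡ = trans
      (∣-∣-cancel (u * (u + y))
        (trans (cong (λ t → Q * x * x + t * (u + y)) (sym u≡)) (ℕ.+-comm (Q * x * x) (u * (u + y))))
        (trans (expand u y) (cong (λ t → u * (u + y) + t)
          (trans (cong (λ u → 1 * y * y + u * y) u≡) (collect m x y)))))
      (ℕ.∣-∣-comm (Q * x * x) (1 * y * y + 2 * m * y * x))
      where
      expand : ∀ u y → 1 * (u + y) * (u + y) ≡ u * (u + y) + (1 * y * y + u * y)
      expand = ℕ-Solver.solve-∀
      collect : ∀ m x y → 1 * y * y + 2 * m * x * y ≡ 1 * y * y + 2 * m * y * x
      collect = ℕ-Solver.solve-∀

  -- Descent along the cycle of forms

  module Descent (b s q m k N : ℕ) (q≡ : q ≡ 4 * b * s + 1) (m≡ : m ≡ b * q ^ k + s)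
    (0<m : 0 < m) (N<q : N < q) (N<Q : N < q ^ k) (nonsquare : ∀ z → z * z ≢ N) where

    open Form b s q m q≡

    -- The outer coefficients are powers of q and N < q, so 1 is the only one that does not exceed
    -- N.
    OneOrLarge : ℕ → Set
    OneOrLarge A = A ≡ 1 ⊎ N < A

    oneOrLarge : ∀ i → OneOrLarge (q ^ i)
    oneOrLarge zero    = inj₁ refl
    oneOrLarge (suc i) = inj₂ (ℕ.<-≤-trans N<q (ℕ.m≤m*n q (q ^ i) {{ℕ.m^n≢0 q i {{>-nonZero (ℕ.≤-<-trans z≤n N<q)}}}}))

    -- No summand is negative, so a single large one suffices: Ax² if A > N, and Cyz if A = 1 and y,
    -- z > 0. What remains is the boundary of the cone and its apex, where the value is a square or
    -- a positive multiple of q.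
    cone : ∀ A C x y z → N < A * C → OneOrLarge A → y + z ≡ 2 * b * A * x →
           A * x * x + 2 * s * x * y + C * y * z ≢ N
    cone A C zero y z N<AC large h eq = nonsquare 0 (begin
      0                                      ≡⟨ identity A C s z ⟨
      A * 0 * 0 + 2 * s * 0 * 0 + C * 0 * z  ≡⟨ cong (λ y → A * 0 * 0 + 2 * s * 0 * y + C * y * z) y≡0 ⟨
      A * 0 * 0 + 2 * s * 0 * y + C * y * z  ≡⟨ eq ⟩
      N                                      ∎)
      where
      open ≡-Reasoning
      y≡0 : y ≡ 0
      y≡0 = ℕ.m+n≡0⇒m≡0 y (trans h (ℕ.*-zeroʳ (2 * b * A)))
      identity : ∀ A C s z → A * 0 * 0 + 2 * s * 0 * 0 + C * 0 * z ≡ 0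
      identity = ℕ-Solver.solve-∀
    cone A C x@(suc _) y z N<AC (inj₂ N<A) h eq = ℕ.<-irrefl refl (begin-strict
      N                                      <⟨ N<A ⟩
      A                                      ≤⟨ ℕ.m≤m*n A x ⟩
      A * x                                  ≤⟨ ℕ.m≤m*n (A * x) x ⟩
      A * x * x                              ≤⟨ ℕ.m≤m+n (A * x * x) (2 * s * x * y) ⟩
      A * x * x + 2 * s * x * y              ≤⟨ ℕ.m≤m+n (A * x * x + 2 * s * x * y) (C * y * z) ⟩
      A * x * x + 2 * s * x * y + C * y * z  ≡⟨ eq ⟩
      N                                      ∎)
      where open ℕ.≤-Reasoning
    cone A C x@(suc _) zero z N<AC (inj₁ refl) h eq = nonsquare x (trans (identity C s x z) eq)
      where
      identity : ∀ C s x z → x * x ≡ 1 * x * x + 2 * s * x * 0 + C * 0 * z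
      identity = ℕ-Solver.solve-∀
    -- On the boundary ray y = 2bx the coefficient C drops out, and x² + 2sxy = (1 + 4bs)x² = qx².
    cone A C x@(suc _) y@(suc _) zero N<AC (inj₁ refl) h eq = ℕ.<-irrefl refl (begin-strict
      N                                          <⟨ N<q ⟩
      q                                          ≤⟨ ℕ.m≤m*n q x ⟩
      q * x                                      ≤⟨ ℕ.m≤m*n (q * x) x ⟩
      q * x * x                                  ≡⟨ cong (λ q → q * x * x) q≡ ⟩
      (4 * b * s + 1) * x * x                    ≡⟨ identity b s C x ⟩
      1 * x * x + 2 * s * x * (2 * b * 1 * x) + C * (2 * b * 1 * x) * 0
        ≡⟨ cong (λ y → 1 * x * x + 2 * s * x * y + C * y * 0) (trans (sym (ℕ.+-identityʳ y)) h) ⟨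
      1 * x * x + 2 * s * x * y + C * y * 0      ≡⟨ eq ⟩
      N                                          ∎)
      where
      open ℕ.≤-Reasoning
      identity : ∀ b s C x → (4 * b * s + 1) * x * x
               ≡ 1 * x * x + 2 * s * x * (2 * b * 1 * x) + C * (2 * b * 1 * x) * 0
      identity = ℕ-Solver.solve-∀
    cone A C x@(suc _) y@(suc _) z@(suc _) N<AC (inj₁ refl) h eq = ℕ.<-irrefl refl (begin-strict
      N                                      <⟨ N<AC ⟩
      1 * C                                  ≡⟨ ℕ.*-identityˡ C ⟩
      C                                      ≤⟨ ℕ.m≤m*n C y ⟩
      C * y                                  ≤⟨ ℕ.m≤m*n (C * y) z ⟩
      C * y * z                              ≤⟨ ℕ.m≤n+m (C * y * z) (1 * x * x + 2 * s * x * y) ⟩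
      1 * x * x + 2 * s * x * y + C * y * z  ≡⟨ eq ⟩
      N                                      ∎)
      where open ℕ.≤-Reasoning

    -- The only strict decrease of the descent. It comes from 2mx > 0, since x = 0 would make the
    -- value the square y².
    turn : ∀ Q x y → N < Q → form Q 1 x y ≡ N → ∃[ y′ ] y′ < y × form 1 Q y′ x ≡ N
    turn Q zero y N<Q eq = ⊥-elim (nonsquare y (trans (sym (cong₂ ∣_-_∣ (left Q m y) (right y))) eq))
      where
      left : ∀ Q m y → Q * 0 * 0 + 2 * m * 0 * y ≡ 0
      left = ℕ-Solver.solve-∀
      right : ∀ y → 1 * y * y ≡ y * y
      right = ℕ-Solver.solve-∀
    turn Q x@(suc _) y N<Q eq with m+o≡n⊎m≡n+o y (2 * m * x)
    ... | inj₁ (z , h) = ⊥-elim (ℕ.<-irrefl refl (begin-strict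
        N                   <⟨ N<Q ⟩
        Q                   ≤⟨ ℕ.m≤m*n Q x ⟩
        Q * x               ≤⟨ ℕ.m≤m*n (Q * x) x ⟩
        Q * x * x           ≤⟨ ℕ.m≤m+n (Q * x * x) (y * z) ⟩
        Q * x * x + y * z   ≡⟨ form-turn-cone Q x y z h ⟨
        form Q 1 x y        ≡⟨ eq ⟩
        N                   ∎))
        where open ℕ.≤-Reasoning
    ... | inj₂ (y′ , refl) = y′ , ℕ.m<n+m y′ positive , trans (sym (form-turn Q x y′ (2 * m * x) refl)) eq
      where
      positive : 0 < 2 * m * x
      positive = >-nonZero⁻¹ (2 * m * x) {{ℕ.m*n≢0 (2 * m) x {{ℕ.m*n≢0 2 m {{_}} {{>-nonZero 0<m}}}}}}

    -- Each of the two substitutions can fail, and each failure is excluded by `cone`: the first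
    -- with leading coefficient A, the second with C. Hence both dichotomies are required.
    step : ∀ A C x y → m ≡ b * (A * (q * C)) + s → N < A * (q * C) → OneOrLarge A → OneOrLarge C →
           form A (q * C) x y ≡ N → ∃₂ λ x′ y′ → x′ ≤ x × y′ ≤ y × form (q * A) C x′ y′ ≡ N
    step A C x y m≡ N<Q largeA largeC eq with m+o≡n⊎m≡n+o y (2 * b * A * x)
    ... | inj₁ (z , h) = ⊥-elim (cone A (q * C) x y z N<Q largeA h
        (trans (sym (form-cone A (q * C) x y z m≡ h)) eq))
    ... | inj₂ (y′ , refl) with m+o≡n⊎m≡n+o x (2 * b * C * y′)
    ...   | inj₁ (z , h) = ⊥-elim (cone C (q * A) y′ z x (subst (N <_) (identity A q C) N<Q) largeC h′
        (trans (sym (form-cone′ A C x y′ z (2 * b * A * x) m≡ refl h′)) eq))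
      where
      h′ = trans (ℕ.+-comm z x) h
      identity : ∀ A q C → A * (q * C) ≡ C * (q * A)
      identity = ℕ-Solver.solve-∀
    ...   | inj₂ (x′ , refl) = x′ , y′ , ℕ.m≤n+m x′ (2 * b * C * y′) , ℕ.m≤n+m y′ (2 * b * A * x) ,
        trans (sym (form-step A C x′ y′ (2 * b * A * x) (2 * b * C * y′) m≡ refl refl)) eq

    -- Lexicographic recursion on `n` and `j`: `step` lowers `j` without raising x + y, and at j = 0
    -- `turn` sets `j` back to `k` but lowers x + y.
    form-nonrep : ∀ n i j x y → x + y < n → i + j ≡ k → form (q ^ i) (q ^ j) x y ≢ N
    form-nonrep (suc n) i zero x y x+y<n i+0≡k eq
      with turn (q ^ i) x y (subst (λ i → N < q ^ i) (trans (sym i+0≡k) (ℕ.+-identityʳ i)) N<Q) eq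
    ... | y′ , y′<y , eq′ = form-nonrep n 0 i y′ x
        (ℕ.<-≤-trans (ℕ.+-monoˡ-< x y′<y) (ℕ.≤-trans (ℕ.≤-reflexive (ℕ.+-comm y x)) (s≤s⁻¹ x+y<n)))
        (trans (sym (ℕ.+-identityʳ i)) i+0≡k) eq′
    form-nonrep n i (suc j) x y x+y<n i+j≡k eq
      with step (q ^ i) (q ^ j) x y (subst (λ Q → m ≡ b * Q + s) Q≡ m≡) (subst (N <_) Q≡ N<Q)
             (oneOrLarge i) (oneOrLarge j) eq
      where
      Q≡ : q ^ k ≡ q ^ i * q ^ suc j
      Q≡ = trans (cong (q ^_) (sym i+j≡k)) (ℕ.^-distribˡ-+-* q i (suc j))
    ... | x′ , y′ , x′≤x , y′≤y , eq′ = form-nonrep n (suc i) j x′ y′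
        (ℕ.≤-<-trans (ℕ.+-mono-≤ x′≤x y′≤y) x+y<n) (trans (sym (ℕ.+-suc i j)) i+j≡k) eq′

    -- If x ≥ my, the shift x = my + x′ gives the first form (1, 2m, -Q). If x ≤ my, the difference
    -- Dy² - x² is at least Qy², which exceeds N unless y = 0.
    pell-nonrep : ∀ x y → ∣ x * x - (q ^ k + m * m) * (y * y) ∣ ≢ N
    pell-nonrep x y eq with m+o≡n⊎m≡n+o x (m * y)
    ... | inj₂ (x′ , refl) = form-nonrep (suc (x′ + y)) 0 k x′ y ℕ.≤-refl refl (trans (sym cancelled) eq)
      where
      cancelled : ∣ (m * y + x′) * (m * y + x′) - (q ^ k + m * m) * (y * y) ∣ ≡ form 1 (q ^ k) x′ y
      cancelled = ∣-∣-cancel (m * y * (m * y)) (left m x′ y) (right (q ^ k) m y)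
        where
        left : ∀ m x y → (m * y + x) * (m * y + x) ≡ m * y * (m * y) + (1 * x * x + 2 * m * x * y)
        left = ℕ-Solver.solve-∀
        right : ∀ Q m y → (Q + m * m) * (y * y) ≡ m * y * (m * y) + Q * y * y
        right = ℕ-Solver.solve-∀
    pell-nonrep x zero eq | inj₁ (z , x+z≡0) = nonsquare 0 (trans
      (sym (cong₂ ∣_-_∣ (cong (λ x → x * x) x≡0) (ℕ.*-zeroʳ (q ^ k + m * m)))) eq)
      where
      x≡0 : x ≡ 0
      x≡0 = ℕ.m+n≡0⇒m≡0 x (trans x+z≡0 (ℕ.*-zeroʳ m))
    pell-nonrep x y@(suc _) eq | inj₁ (z , x+z≡my) = ℕ.<-irrefl refl (begin-strict
      N                                             <⟨ N<Q ⟩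
      q ^ k                                         ≤⟨ ℕ.m≤m*n (q ^ k) (y * y) ⟩
      q ^ k * (y * y)                               ≤⟨ ℕ.m≤n+m (q ^ k * (y * y)) (2 * x * z + z * z) ⟩
      excess                                        ≡⟨ ∣-∣-cancel (x * x) (sym (ℕ.+-identityʳ (x * x))) square ⟨
      ∣ x * x - (q ^ k + m * m) * (y * y) ∣         ≡⟨ eq ⟩
      N                                             ∎)
      where
      open ℕ.≤-Reasoning
      excess = 2 * x * z + z * z + q ^ k * (y * y)
      expand : ∀ Q m y → (Q + m * m) * (y * y) ≡ m * y * (m * y) + Q * (y * y)
      expand = ℕ-Solver.solve-∀
      collect : ∀ E x z → (x + z) * (x + z) + E ≡ x * x + (2 * x * z + z * z + E)
      collect = ℕ-Solver.solve-∀
      square : (q ^ k + m * m) * (y * y) ≡ x * x + excess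
      square = trans (expand (q ^ k) m y) (trans (cong (λ t → t * t + q ^ k * (y * y)) (sym x+z≡my))
        (collect (q ^ k * (y * y)) x z))

-- Integrality of rational numbers

ringℚ = ACR.fromCommutativeRing ℚ.+-*-commutativeRing λ x → dec⇒maybe (0ℚ ℚ.≟ x)

ringℤ = ACR.fromCommutativeRing ℤ.+-*-commutativeRing λ x → dec⇒maybe (0ℤ ℤ.≟ x)

ι : ℤ → ℚ
ι z = z ℚ./ 1

toℚᵘ-ι : ∀ z → toℚᵘ (ι z) ℚᵘ.≃ mkℚᵘ z 0
toℚᵘ-ι z = ℚ.toℚᵘ-fromℚᵘ (mkℚᵘ z 0)

ι-injective : ∀ x y → ι x ≡ ι y → x ≡ y
ι-injective x y eq with ℚᵘ.≃-trans (ℚᵘ.≃-sym (toℚᵘ-ι x)) (ℚᵘ.≃-trans (ℚ.toℚᵘ-cong eq) (toℚᵘ-ι y))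
... | *≡* x*1≡y*1 = trans (sym (ℤ.*-identityʳ x)) (trans x*1≡y*1 (ℤ.*-identityʳ y))

ι-+ : ∀ x y → ι (x ℤ.+ y) ≡ ι x ℚ.+ ι y
ι-+ x y = ℚ.toℚᵘ-injective (ℚᵘ.≃-trans (toℚᵘ-ι (x ℤ.+ y)) (ℚᵘ.≃-trans
  (*≡* (identity x y))
  (ℚᵘ.≃-sym (ℚᵘ.≃-trans (ℚ.toℚᵘ-homo-+ (ι x) (ι y)) (ℚᵘ.+-cong (toℚᵘ-ι x) (toℚᵘ-ι y))))))
  where
  identity : ∀ x y → (x ℤ.+ y) ℤ.* 1ℤ ≡ (x ℤ.* 1ℤ ℤ.+ y ℤ.* 1ℤ) ℤ.* 1ℤ
  identity = solve-∀ ringℤ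

ι-* : ∀ x y → ι (x ℤ.* y) ≡ ι x ℚ.* ι y
ι-* x y = ℚ.toℚᵘ-injective (ℚᵘ.≃-trans (toℚᵘ-ι (x ℤ.* y))
  (ℚᵘ.≃-sym (ℚᵘ.≃-trans (ℚ.toℚᵘ-homo-* (ι x) (ι y)) (ℚᵘ.*-cong (toℚᵘ-ι x) (toℚᵘ-ι y)))))

ι-neg : ∀ x → ι (ℤ.- x) ≡ ℚ.- ι x
ι-neg x = ℚ.toℚᵘ-injective (ℚᵘ.≃-trans (toℚᵘ-ι (ℤ.- x))
  (ℚᵘ.≃-sym (ℚᵘ.≃-trans (ℚ.toℚᵘ-homo‿- (ι x)) (ℚᵘ.-‿cong (toℚᵘ-ι x)))))

ι-numerator : ∀ r → ι (ℚ.↧ r) ℚ.* r ≡ ι (ℚ.↥ r)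
ι-numerator r@(mkℚ u d _) = ℚ.toℚᵘ-injective (ℚᵘ.≃-trans (ℚ.toℚᵘ-homo-* (ι (ℚ.↧ r)) r) (ℚᵘ.≃-trans
  (ℚᵘ.*-cong (toℚᵘ-ι (ℚ.↧ r)) (ℚᵘ.≃-refl {toℚᵘ r}))
  (ℚᵘ.≃-trans (*≡* (identity (+ suc d) u)) (ℚᵘ.≃-sym (toℚᵘ-ι u)))))
  where
  identity : ∀ v u → v ℤ.* u ℤ.* 1ℤ ≡ u ℤ.* (1ℤ ℤ.* v)
  identity = solve-∀ ringℤ

IsInteger : ℚ → Set
IsInteger r = ∃[ z ] r ≡ ι z

denominator-1⇒integer : ∀ r → ℚ.↧ r ≡ 1ℤ → IsInteger r
denominator-1⇒integer r eq = ℚ.↥ r , (begin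
  r                    ≡⟨ ℚ.*-identityˡ r ⟨
  1ℚ ℚ.* r             ≡⟨ cong (λ t → ι t ℚ.* r) eq ⟨
  ι (ℚ.↧ r) ℚ.* r      ≡⟨ ι-numerator r ⟩
  ι (ℚ.↥ r)            ∎)
  where open ≡-Reasoning

coprime-*ˡ : ∀ {m m′ n} → Coprime m n → Coprime m′ n → Coprime (m ℕ.* m′) n
coprime-*ˡ {m} {m′} {n} c c′ {d} (d∣mm′ , d∣n) = c′ (coprime-divisor d⊥m d∣mm′ , d∣n)
  where
  d⊥m : Coprime d m
  d⊥m (e∣d , e∣m) = c (e∣m , ∣.∣-trans e∣d d∣n)

coprime-^ˡ : ∀ {m n} j → Coprime m n → Coprime (m ℕ.^ j) n
coprime-^ˡ {n = n} zero    c = 1-coprimeTo n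
coprime-^ˡ         (suc j) c = coprime-*ˡ c (coprime-^ˡ j c)

coprime-^ : ∀ {m n} i j → Coprime m n → Coprime (m ℕ.^ i) (n ℕ.^ j)
coprime-^ i j c = coprime-^ˡ i (Coprime.sym (coprime-^ˡ j (Coprime.sym c)))

j<2^j : ∀ j → j ℕ.< 2 ℕ.^ j
j<2^j zero    = s≤s z≤n
j<2^j (suc j) = ℕ.≤-trans (ℕ.+-mono-≤ (ℕ.m^n>0 2 j) (j<2^j j))
  (ℕ.≤-reflexive (cong (2 ℕ.^ j ℕ.+_) (sym (ℕ.+-identityʳ (2 ℕ.^ j)))))

powers-divide⇒≡1 : ∀ v d → d ≢ 0 → (∀ j → v ℕ.^ j ∣ d) → v ≡ 1
powers-divide⇒≡1 zero d d≢0 v^j∣d = ⊥-elim (d≢0 (∣.0∣⇒≡0 (v^j∣d 1)))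
powers-divide⇒≡1 1 d d≢0 v^j∣d = refl
-- The exponent j = d is already too large: d < 2^d ≤ v^d.
powers-divide⇒≡1 v@(suc (suc _)) d d≢0 v^j∣d = ⊥-elim (ℕ.<-irrefl refl (ℕ.<-≤-trans (j<2^j d)
  (ℕ.≤-trans (ℕ.^-monoˡ-≤ d (s≤s (s≤s z≤n))) (∣.∣⇒≤ {{ℕ.≢-nonZero d≢0}} (v^j∣d d)))))

infixr 8 _^ℚ_
_^ℚ_ : ℚ → ℕ → ℚ
r ^ℚ zero  = 1ℚ
r ^ℚ suc j = r ℚ.* r ^ℚ j

ι-^ : ∀ z j → ι (z ℤ.^ j) ≡ ι z ^ℚ j
ι-^ z zero    = refl
ι-^ z (suc j) = trans (ι-* z (z ℤ.^ j)) (cong (ι z ℚ.*_) (ι-^ z j))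

*-^ℚ : ∀ r t j → (r ℚ.* t) ^ℚ j ≡ r ^ℚ j ℚ.* t ^ℚ j
*-^ℚ r t zero    = refl
*-^ℚ r t (suc j) = trans (cong (r ℚ.* t ℚ.*_) (*-^ℚ r t j)) (identity r t (r ^ℚ j) (t ^ℚ j))
  where
  identity : ∀ a b c d → a ℚ.* b ℚ.* (c ℚ.* d) ≡ a ℚ.* c ℚ.* (b ℚ.* d)
  identity = solve-∀ ringℚ

abs-^ : ∀ z j → ∣ z ℤ.^ j ∣ ≡ ∣ z ∣ ℕ.^ j
abs-^ z zero    = refl
abs-^ z (suc j) = trans (ℤ.abs-* z (z ℤ.^ j)) (cong (∣ z ∣ ℕ.*_) (abs-^ z j))

-- For r = u/v in lowest terms, v^j divides u^j d and is prime to u^j, so every power of v divides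
-- d.
bounded-denominators⇒integer : ∀ r d → d ≢ 0ℤ → (∀ j → IsInteger (ι d ℚ.* r ^ℚ j)) → IsInteger r
bounded-denominators⇒integer r@(mkℚ u v-1 u⊥v) d d≢0 bounded =
  denominator-1⇒integer r (cong +_ (powers-divide⇒≡1 v ∣ d ∣ (λ eq → d≢0 (ℤ.∣i∣≡0⇒i≡0 eq)) v^j∣d))
  where
  v = suc v-1
  open ≡-Reasoning
  v^j∣d : ∀ j → v ℕ.^ j ∣ ∣ d ∣
  v^j∣d j with bounded j
  ... | z , dr^j≡z = coprime-divisor (Coprime.sym (coprime-^ j j (Coprime.recompute u⊥v)))
          (divides ∣ z ∣ (begin
    ∣ u ∣ ℕ.^ j ℕ.* ∣ d ∣         ≡⟨ cong (ℕ._* ∣ d ∣) (abs-^ u j) ⟨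
    ∣ u ℤ.^ j ∣ ℕ.* ∣ d ∣         ≡⟨ ℤ.abs-* (u ℤ.^ j) d ⟨
    ∣ u ℤ.^ j ℤ.* d ∣             ≡⟨ cong ∣_∣ (ι-injective (u ℤ.^ j ℤ.* d) (z ℤ.* (+ v) ℤ.^ j) cleared) ⟩
    ∣ z ℤ.* (+ v) ℤ.^ j ∣         ≡⟨ ℤ.abs-* z ((+ v) ℤ.^ j) ⟩
    ∣ z ∣ ℕ.* ∣ (+ v) ℤ.^ j ∣     ≡⟨ cong (∣ z ∣ ℕ.*_) (abs-^ (+ v) j) ⟩
    ∣ z ∣ ℕ.* v ℕ.^ j             ∎))
    where
    swap : ∀ a b c → a ℚ.* b ℚ.* c ≡ c ℚ.* b ℚ.* a
    swap = solve-∀ ringℚ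
    cleared : ι (u ℤ.^ j ℤ.* d) ≡ ι (z ℤ.* (+ v) ℤ.^ j)
    cleared = begin
      ι (u ℤ.^ j ℤ.* d)                    ≡⟨ ι-* (u ℤ.^ j) d ⟩
      ι (u ℤ.^ j) ℚ.* ι d                  ≡⟨ cong (ℚ._* ι d) (ι-^ u j) ⟩
      ι u ^ℚ j ℚ.* ι d                     ≡⟨ cong (λ t → t ^ℚ j ℚ.* ι d) (ι-numerator r) ⟨
      (ι (+ v) ℚ.* r) ^ℚ j ℚ.* ι d         ≡⟨ cong (ℚ._* ι d) (*-^ℚ (ι (+ v)) r j) ⟩
      ι (+ v) ^ℚ j ℚ.* r ^ℚ j ℚ.* ι d      ≡⟨ swap (ι (+ v) ^ℚ j) (r ^ℚ j) (ι d) ⟩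
      ι d ℚ.* r ^ℚ j ℚ.* ι (+ v) ^ℚ j      ≡⟨ cong₂ ℚ._*_ dr^j≡z (sym (ι-^ (+ v) j)) ⟩
      ι z ℚ.* ι ((+ v) ℤ.^ j)              ≡⟨ ι-* z ((+ v) ℤ.^ j) ⟨
      ι (z ℤ.* (+ v) ℤ.^ j)                ∎

-- For r = u/v in lowest terms, v² divides u²D and hence D.
squarefree⇒integer : ∀ {D} → Squarefree D → ∀ r → IsInteger (ι (+ D) ℚ.* (r ℚ.* r)) → IsInteger r
squarefree⇒integer {D} sf r@(mkℚ u v-1 u⊥v) (z , Dr²≡z) =
  denominator-1⇒integer r (cong +_ (sf v (coprime-divisor (coprime-*ˡ v⊥u² v⊥u²) v²∣u²D)))
  where
  v = suc v-1
  open ≡-Reasoning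
  v⊥u : Coprime v ∣ u ∣
  v⊥u = Coprime.sym (Coprime.recompute u⊥v)
  v⊥u² : Coprime v (∣ u ∣ ℕ.* ∣ u ∣)
  v⊥u² = Coprime.sym (coprime-*ˡ (Coprime.sym v⊥u) (Coprime.sym v⊥u))
  identity : ∀ a b c → a ℚ.* b ℚ.* (a ℚ.* b) ℚ.* c ≡ c ℚ.* (b ℚ.* b) ℚ.* (a ℚ.* a)
  identity = solve-∀ ringℚ
  cleared : ι (u ℤ.* u ℤ.* + D) ≡ ι (z ℤ.* (+ v ℤ.* + v))
  cleared = begin
    ι (u ℤ.* u ℤ.* + D)                                ≡⟨ ι-* (u ℤ.* u) (+ D) ⟩
    ι (u ℤ.* u) ℚ.* ι (+ D)                            ≡⟨ cong (ℚ._* ι (+ D)) (ι-* u u) ⟩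
    ι u ℚ.* ι u ℚ.* ι (+ D)                            ≡⟨ cong (λ t → t ℚ.* t ℚ.* ι (+ D)) (ι-numerator r) ⟨
    ι (+ v) ℚ.* r ℚ.* (ι (+ v) ℚ.* r) ℚ.* ι (+ D)      ≡⟨ identity (ι (+ v)) r (ι (+ D)) ⟩
    ι (+ D) ℚ.* (r ℚ.* r) ℚ.* (ι (+ v) ℚ.* ι (+ v))    ≡⟨ cong₂ ℚ._*_ Dr²≡z (sym (ι-* (+ v) (+ v))) ⟩
    ι z ℚ.* ι (+ v ℤ.* + v)                            ≡⟨ ι-* z (+ v ℤ.* + v) ⟨
    ι (z ℤ.* (+ v ℤ.* + v))                            ∎
  v²∣u²D : v ℕ.* v ∣ ∣ u ∣ ℕ.* ∣ u ∣ ℕ.* D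
  v²∣u²D = divides ∣ z ∣ (begin
    ∣ u ∣ ℕ.* ∣ u ∣ ℕ.* D           ≡⟨ cong (ℕ._* D) (ℤ.abs-* u u) ⟨
    ∣ u ℤ.* u ∣ ℕ.* D               ≡⟨ ℤ.abs-* (u ℤ.* u) (+ D) ⟨
    ∣ u ℤ.* u ℤ.* + D ∣             ≡⟨ cong ∣_∣ (ι-injective (u ℤ.* u ℤ.* + D) (z ℤ.* (+ v ℤ.* + v)) cleared) ⟩
    ∣ z ℤ.* (+ v ℤ.* + v) ∣         ≡⟨ ℤ.abs-* z (+ v ℤ.* + v) ⟩
    ∣ z ∣ ℕ.* ∣ + v ℤ.* + v ∣       ≡⟨ cong (∣ z ∣ ℕ.*_) (ℤ.abs-* (+ v) (+ v)) ⟩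
    ∣ z ∣ ℕ.* (v ℕ.* v)             ∎)

-- Integral elements of ℚ(√D)

*-nonzero : ∀ {i j} → i ≢ 0ℤ → j ≢ 0ℤ → i ℤ.* j ≢ 0ℤ
*-nonzero {i} {j} i≢0 j≢0 eq with ℤ.i*j≡0⇒i≡0∨j≡0 i {j} eq
... | inj₁ i≡0 = i≢0 i≡0
... | inj₂ j≡0 = j≢0 j≡0

module Field (D : ℕ) where
  open QuadraticField D public

  *-assoc : ∀ x y z → x * y * z ≡ x * (y * z)
  *-assoc (a +√D b) (c +√D d) (e +√D f) = cong₂ _+√D_ (rational Dℚ a b c d e f) (irrational Dℚ a b c d e f)
    where
    rational : ∀ D a b c d e f →
      (a ℚ.* c ℚ.+ D ℚ.* (b ℚ.* d)) ℚ.* e ℚ.+ D ℚ.* ((a ℚ.* d ℚ.+ b ℚ.* c) ℚ.* f)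
      ≡ a ℚ.* (c ℚ.* e ℚ.+ D ℚ.* (d ℚ.* f)) ℚ.+ D ℚ.* (b ℚ.* (c ℚ.* f ℚ.+ d ℚ.* e))
    rational = solve-∀ ringℚ
    irrational : ∀ D a b c d e f →
      (a ℚ.* c ℚ.+ D ℚ.* (b ℚ.* d)) ℚ.* f ℚ.+ (a ℚ.* d ℚ.+ b ℚ.* c) ℚ.* e
      ≡ a ℚ.* (c ℚ.* f ℚ.+ d ℚ.* e) ℚ.+ b ℚ.* (c ℚ.* e ℚ.+ D ℚ.* (d ℚ.* f))
    irrational = solve-∀ ringℚ

  *-comm : ∀ x y → x * y ≡ y * x
  *-comm (a +√D b) (c +√D d) = cong₂ _+√D_ (rational Dℚ a b c d) (irrational a b c d)
    where
    rational : ∀ D a b c d → a ℚ.* c ℚ.+ D ℚ.* (b ℚ.* d) ≡ c ℚ.* a ℚ.+ D ℚ.* (d ℚ.* b)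
    rational = solve-∀ ringℚ
    irrational : ∀ a b c d → a ℚ.* d ℚ.+ b ℚ.* c ≡ c ℚ.* b ℚ.+ d ℚ.* a
    irrational = solve-∀ ringℚ

  *-distribˡ-+ : ∀ x y z → x * (y + z) ≡ x * y + x * z
  *-distribˡ-+ (a +√D b) (c +√D d) (e +√D f) = cong₂ _+√D_ (rational Dℚ a b c d e f) (irrational a b c d e f)
    where
    rational : ∀ D a b c d e f → a ℚ.* (c ℚ.+ e) ℚ.+ D ℚ.* (b ℚ.* (d ℚ.+ f))
             ≡ a ℚ.* c ℚ.+ D ℚ.* (b ℚ.* d) ℚ.+ (a ℚ.* e ℚ.+ D ℚ.* (b ℚ.* f))
    rational = solve-∀ ringℚ
    irrational : ∀ a b c d e f → a ℚ.* (d ℚ.+ f) ℚ.+ b ℚ.* (c ℚ.+ e)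
               ≡ a ℚ.* d ℚ.+ b ℚ.* c ℚ.+ (a ℚ.* f ℚ.+ b ℚ.* e)
    irrational = solve-∀ ringℚ

  *-distribʳ-+ : ∀ x y z → (y + z) * x ≡ y * x + z * x
  *-distribʳ-+ x y z = trans (*-comm (y + z) x) (trans (*-distribˡ-+ x y z) (cong₂ _+_ (*-comm x y) (*-comm x z)))

  fromℤ-* : ∀ c x → fromℤ c * x ≡ (ι c ℚ.* re x) +√D (ι c ℚ.* im x)
  fromℤ-* c (a +√D b) = cong₂ _+√D_ (rational Dℚ (ι c) a b) (irrational (ι c) a b)
    where
    rational : ∀ D c a b → c ℚ.* a ℚ.+ D ℚ.* (0ℚ ℚ.* b) ≡ c ℚ.* a
    rational = solve-∀ ringℚ
    irrational : ∀ c a b → c ℚ.* b ℚ.+ 0ℚ ℚ.* a ≡ c ℚ.* b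
    irrational = solve-∀ ringℚ

  *-identityˡ : ∀ x → 1K * x ≡ x
  *-identityˡ x = trans (fromℤ-* 1ℤ x) (cong₂ _+√D_ (ℚ.*-identityˡ (re x)) (ℚ.*-identityˡ (im x)))

  *-identityʳ : ∀ x → x * 1K ≡ x
  *-identityʳ x = trans (*-comm x 1K) (*-identityˡ x)

  *-zeroʳ : ∀ x → x * 0K ≡ 0K
  *-zeroʳ x = trans (*-comm x 0K) (trans (fromℤ-* 0ℤ x) (cong₂ _+√D_ (ℚ.*-zeroˡ (re x)) (ℚ.*-zeroˡ (im x))))

  norm : K → ℚ
  norm (a +√D b) = a ℚ.* a ℚ.- Dℚ ℚ.* (b ℚ.* b)

  norm-* : ∀ x y → norm (x * y) ≡ norm x ℚ.* norm y
  norm-* (a +√D b) (c +√D d) = identity Dℚ a b c d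
    where
    identity : ∀ D a b c d →
      (a ℚ.* c ℚ.+ D ℚ.* (b ℚ.* d)) ℚ.* (a ℚ.* c ℚ.+ D ℚ.* (b ℚ.* d))
        ℚ.- D ℚ.* ((a ℚ.* d ℚ.+ b ℚ.* c) ℚ.* (a ℚ.* d ℚ.+ b ℚ.* c))
      ≡ (a ℚ.* a ℚ.- D ℚ.* (b ℚ.* b)) ℚ.* (c ℚ.* c ℚ.- D ℚ.* (d ℚ.* d))
    identity = solve-∀ ringℚ

  infixr 8 _^_
  _^_ : K → ℕ → K
  x ^ zero  = 1K
  x ^ suc j = x * x ^ j

  norm-^ : ∀ x j → norm (x ^ j) ≡ norm x ^ℚ j
  norm-^ x zero    = identity Dℚ
    where
    identity : ∀ D → 1ℚ ℚ.* 1ℚ ℚ.- D ℚ.* (0ℚ ℚ.* 0ℚ) ≡ 1ℚ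
    identity = solve-∀ ringℚ
  norm-^ x (suc j) = trans (norm-* x (x ^ j)) (cong (norm x ℚ.*_) (norm-^ x j))

  -- dz ∈ ℤ[√D].
  Cleared : ℤ → K → Set
  Cleared d z = IsInteger (ι d ℚ.* re z) × IsInteger (ι d ℚ.* im z)

  cleared-+ : ∀ d x y → Cleared d x → Cleared d y → Cleared d (x + y)
  cleared-+ d (a +√D b) (a′ +√D b′) ((p , ≡p) , (r , ≡r)) ((p′ , ≡p′) , (r′ , ≡r′)) =
    (p ℤ.+ p′ , add a a′ p p′ ≡p ≡p′) , (r ℤ.+ r′ , add b b′ r r′ ≡r ≡r′)
    where
    add : ∀ a a′ p p′ → ι d ℚ.* a ≡ ι p → ι d ℚ.* a′ ≡ ι p′ → ι d ℚ.* (a ℚ.+ a′) ≡ ι (p ℤ.+ p′)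
    add a a′ p p′ ≡p ≡p′ = trans (ℚ.*-distribˡ-+ (ι d) a a′) (trans (cong₂ ℚ._+_ ≡p ≡p′) (sym (ι-+ p p′)))

  cleared-fromℤ-* : ∀ d c x → Cleared d x → Cleared d (fromℤ c * x)
  cleared-fromℤ-* d c x ((p , ≡p) , (r , ≡r)) = subst (Cleared d) (sym (fromℤ-* c x))
    ((c ℤ.* p , scale (re x) p ≡p) , (c ℤ.* r , scale (im x) r ≡r))
    where
    swap : ∀ d c a → d ℚ.* (c ℚ.* a) ≡ c ℚ.* (d ℚ.* a)
    swap = solve-∀ ringℚ
    scale : ∀ a p → ι d ℚ.* a ≡ ι p → ι d ℚ.* (ι c ℚ.* a) ≡ ι (c ℤ.* p)
    scale a p ≡p = trans (swap (ι d) (ι c) a) (trans (cong (ι c ℚ.*_) ≡p) (sym (ι-* c p)))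

  cleared-0K : ∀ d → Cleared d 0K
  cleared-0K d = (0ℤ , ℚ.*-zeroʳ (ι d)) , (0ℤ , ℚ.*-zeroʳ (ι d))

  cleared-* : ∀ d e x y → Cleared d x → Cleared e y → Cleared (d ℤ.* e) (x * y)
  cleared-* d e (a +√D b) (a′ +√D b′) ((p , ≡p) , (r , ≡r)) ((p′ , ≡p′) , (r′ , ≡r′)) =
    (p ℤ.* p′ ℤ.+ + D ℤ.* (r ℤ.* r′) , (begin
      ι (d ℤ.* e) ℚ.* (a ℚ.* a′ ℚ.+ Dℚ ℚ.* (b ℚ.* b′))
        ≡⟨ cong (ℚ._* (a ℚ.* a′ ℚ.+ Dℚ ℚ.* (b ℚ.* b′))) (ι-* d e) ⟩
      ι d ℚ.* ι e ℚ.* (a ℚ.* a′ ℚ.+ Dℚ ℚ.* (b ℚ.* b′))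
        ≡⟨ rational (ι d) (ι e) Dℚ a b a′ b′ ⟩
      ι d ℚ.* a ℚ.* (ι e ℚ.* a′) ℚ.+ Dℚ ℚ.* (ι d ℚ.* b ℚ.* (ι e ℚ.* b′))
        ≡⟨ cong₂ (λ t u → t ℚ.+ Dℚ ℚ.* u) (cong₂ ℚ._*_ ≡p ≡p′) (cong₂ ℚ._*_ ≡r ≡r′) ⟩
      ι p ℚ.* ι p′ ℚ.+ Dℚ ℚ.* (ι r ℚ.* ι r′)
        ≡⟨ ι-re p r p′ r′ ⟨
      ι (p ℤ.* p′ ℤ.+ + D ℤ.* (r ℤ.* r′)) ∎)) ,
    (p ℤ.* r′ ℤ.+ r ℤ.* p′ , (begin
      ι (d ℤ.* e) ℚ.* (a ℚ.* b′ ℚ.+ b ℚ.* a′)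
        ≡⟨ cong (ℚ._* (a ℚ.* b′ ℚ.+ b ℚ.* a′)) (ι-* d e) ⟩
      ι d ℚ.* ι e ℚ.* (a ℚ.* b′ ℚ.+ b ℚ.* a′)
        ≡⟨ irrational (ι d) (ι e) a b a′ b′ ⟩
      ι d ℚ.* a ℚ.* (ι e ℚ.* b′) ℚ.+ ι d ℚ.* b ℚ.* (ι e ℚ.* a′)
        ≡⟨ cong₂ ℚ._+_ (cong₂ ℚ._*_ ≡p ≡r′) (cong₂ ℚ._*_ ≡r ≡p′) ⟩
      ι p ℚ.* ι r′ ℚ.+ ι r ℚ.* ι p′
        ≡⟨ ι-im p r p′ r′ ⟨
      ι (p ℤ.* r′ ℤ.+ r ℤ.* p′) ∎))
    where
    open ≡-Reasoning
    ι-re : ∀ p r p′ r′ → ι (p ℤ.* p′ ℤ.+ + D ℤ.* (r ℤ.* r′)) ≡ ι p ℚ.* ι p′ ℚ.+ Dℚ ℚ.* (ι r ℚ.* ι r′)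
    ι-re p r p′ r′ = trans (ι-+ (p ℤ.* p′) (+ D ℤ.* (r ℤ.* r′)))
      (cong₂ ℚ._+_ (ι-* p p′) (trans (ι-* (+ D) (r ℤ.* r′)) (cong (Dℚ ℚ.*_) (ι-* r r′))))
    ι-im : ∀ p r p′ r′ → ι (p ℤ.* r′ ℤ.+ r ℤ.* p′) ≡ ι p ℚ.* ι r′ ℚ.+ ι r ℚ.* ι p′
    ι-im p r p′ r′ = trans (ι-+ (p ℤ.* r′) (r ℤ.* p′)) (cong₂ ℚ._+_ (ι-* p r′) (ι-* r p′))
    rational : ∀ d e D a b a′ b′ → d ℚ.* e ℚ.* (a ℚ.* a′ ℚ.+ D ℚ.* (b ℚ.* b′))
             ≡ d ℚ.* a ℚ.* (e ℚ.* a′) ℚ.+ D ℚ.* (d ℚ.* b ℚ.* (e ℚ.* b′))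
    rational = solve-∀ ringℚ
    irrational : ∀ d e a b a′ b′ → d ℚ.* e ℚ.* (a ℚ.* b′ ℚ.+ b ℚ.* a′)
               ≡ d ℚ.* a ℚ.* (e ℚ.* b′) ℚ.+ d ℚ.* b ℚ.* (e ℚ.* a′)
    irrational = solve-∀ ringℚ

  cleared-1K : ∀ d → Cleared d 1K
  cleared-1K d = (d , ℚ.*-identityʳ (ι d)) , (0ℤ , ℚ.*-zeroʳ (ι d))

  common-denominator : ∀ x → ∃[ e ] e ≢ 0ℤ × Cleared e x
  common-denominator x@(r +√D t) = ℚ.↧ r ℤ.* ℚ.↧ t , *-nonzero {ℚ.↧ r} {ℚ.↧ t} (λ ()) (λ ()) ,
    ((ℚ.↧ t ℤ.* ℚ.↥ r , (begin
      ι (ℚ.↧ r ℤ.* ℚ.↧ t) ℚ.* r         ≡⟨ cong (λ e → ι e ℚ.* r) (ℤ.*-comm (ℚ.↧ r) (ℚ.↧ t)) ⟩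
      ι (ℚ.↧ t ℤ.* ℚ.↧ r) ℚ.* r         ≡⟨ clear (ℚ.↧ t) r ⟩
      ι (ℚ.↧ t ℤ.* ℚ.↥ r)               ∎)) ,
     (ℚ.↧ r ℤ.* ℚ.↥ t , clear (ℚ.↧ r) t))
    where
    open ≡-Reasoning
    clear : ∀ e r → ι (e ℤ.* ℚ.↧ r) ℚ.* r ≡ ι (e ℤ.* ℚ.↥ r)
    clear e r = begin
      ι (e ℤ.* ℚ.↧ r) ℚ.* r        ≡⟨ cong (ℚ._* r) (ι-* e (ℚ.↧ r)) ⟩
      ι e ℚ.* ι (ℚ.↧ r) ℚ.* r      ≡⟨ ℚ.*-assoc (ι e) (ι (ℚ.↧ r)) r ⟩
      ι e ℚ.* (ι (ℚ.↧ r) ℚ.* r)    ≡⟨ cong (ι e ℚ.*_) (ι-numerator r) ⟩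
      ι e ℚ.* ι (ℚ.↥ r)            ≡⟨ ι-* e (ℚ.↥ r) ⟨
      ι (e ℤ.* ℚ.↥ r)              ∎

  powers-cleared-below : ∀ x n → ∃[ d ] d ≢ 0ℤ × (∀ i → i ℕ.< n → Cleared d (x ^ i))
  powers-cleared-below x zero = 1ℤ , (λ ()) , λ _ ()
  powers-cleared-below x (suc n) =
    let e , e≢0 , cleared-x = common-denominator x
        d , d≢0 , cleared   = powers-cleared-below x n
    in e ℤ.* d , *-nonzero e≢0 d≢0 , λ where
      zero    _         → cleared-1K (e ℤ.* d)
      (suc i) (s≤s i<n) → cleared-* e d x (x ^ i) cleared-x (cleared i i<n)

  module _ (S : K → Set) (S-+ : ∀ x y → S x → S y → S (x + y)) (S-fromℤ-* : ∀ c x → S x → S (fromℤ c * x))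
    where

    +-cancelˡ : ∀ x y → S x → S (x + y) → S y
    +-cancelˡ x@(a +√D b) y@(c +√D d) x∈S x+y∈S = subst S
      (trans (cong (λ t → x + y + t) (fromℤ-* -1ℤ x)) (cong₂ _+√D_ (cancel a c) (cancel b d)))
      (S-+ (x + y) (fromℤ -1ℤ * x) x+y∈S (S-fromℤ-* -1ℤ x x∈S))
      where
      cancel : ∀ a c → a ℚ.+ c ℚ.+ ι -1ℤ ℚ.* a ≡ c
      cancel = solve-∀ ringℚ

    -- Horner's scheme: subtracting the constant term cy leaves yx times a shorter monic polynomial.
    -- The factor `y` is there to absorb that x in the induction.
    leading-power : ∀ cs x y → (∀ i → i ℕ.< length cs → S (y * x ^ i)) → S (y * evalMonic cs x) →
                    S (y * x ^ length cs)
    leading-power []       x y _     yf∈S = yf∈S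
    leading-power (c ∷ cs) x y lower yf∈S = subst S (*-assoc y x (x ^ length cs))
      (leading-power cs x (y * x) (λ i i<n → subst S (sym (*-assoc y x (x ^ i))) (lower (suc i) (s≤s i<n)))
        (+-cancelˡ (y * fromℤ c) (y * x * f) cy∈S (subst S split yf∈S)))
      where
      f = evalMonic cs x
      split : y * (fromℤ c + x * f) ≡ y * fromℤ c + y * x * f
      split = trans (*-distribˡ-+ y (fromℤ c) (x * f)) (cong (λ t → y * fromℤ c + t) (sym (*-assoc y x f)))
      cy∈S : S (y * fromℤ c)
      cy∈S = subst S (trans (cong (fromℤ c *_) (*-identityʳ y)) (*-comm (fromℤ c) y))
        (S-fromℤ-* c (y * 1K) (lower 0 (s≤s z≤n)))

    -- A window of consecutive powers, as long as the degree, slides up one place at a time: the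
    -- equation f(x) = 0 multiplied by x^j puts the next power into S.
    root-powers : S 0K → ∀ cs x → evalMonic cs x ≡ 0K → (∀ i → i ℕ.< length cs → S (x ^ i)) →
                  ∀ j → S (x ^ j)
    root-powers 0∈S cs x root low j =
      subst S (*-identityʳ (x ^ j)) (first cs root (shifted j))
      where
      next : ∀ y → (∀ i → i ℕ.< length cs → S (y * x ^ i)) → S (y * x ^ length cs)
      next y lower = leading-power cs x y lower (subst S (sym (trans (cong (y *_) root) (*-zeroʳ y))) 0∈S)
      shifted : ∀ j i → i ℕ.< length cs → S (x ^ j * x ^ i)
      shifted zero    i i<n = subst S (sym (*-identityˡ (x ^ i))) (low i i<n)
      shifted (suc j) i i<n = subst S shift (at (suc i) (ℕ.m≤n⇒m<n∨m≡n i<n))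
        where
        shift : x ^ j * (x * x ^ i) ≡ x * x ^ j * x ^ i
        shift = trans (sym (*-assoc (x ^ j) x (x ^ i))) (cong (_* x ^ i) (*-comm (x ^ j) x))
        at : ∀ i → i ℕ.< length cs ⊎ i ≡ length cs → S (x ^ j * x ^ i)
        at i (inj₁ i<n)  = shifted j i i<n
        at i (inj₂ refl) = next (x ^ j) (shifted j)
      first : ∀ cs → evalMonic cs x ≡ 0K → (∀ i → i ℕ.< length cs → S (x ^ j * x ^ i)) → S (x ^ j * 1K)
      -- In degree 0 the window is empty, and `root` says 1 = 0, which makes every power zero.
      first []       root _     = subst S (sym (trans (cong (x ^ j *_) root) (*-zeroʳ (x ^ j)))) 0∈S
      first (_ ∷ _)  _    lower = lower 0 (s≤s z≤n)

  integral⇒powers-cleared : ∀ x → IsIntegral x → ∃[ d ] d ≢ 0ℤ × (∀ j → Cleared d (x ^ j))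
  integral⇒powers-cleared x (cs , root) =
    let d , d≢0 , low = powers-cleared-below x (length cs)
    in d , d≢0 , root-powers (Cleared d) (cleared-+ d) (cleared-fromℤ-* d) (cleared-0K d) cs x root low

  cleared⇒norm-integer : ∀ d x → Cleared d x → IsInteger (ι (d ℤ.* d) ℚ.* norm x)
  cleared⇒norm-integer d (a +√D b) ((p , ≡p) , (r , ≡r)) = p ℤ.* p ℤ.- + D ℤ.* (r ℤ.* r) , (begin
    ι (d ℤ.* d) ℚ.* (a ℚ.* a ℚ.- Dℚ ℚ.* (b ℚ.* b))
      ≡⟨ cong (ℚ._* (a ℚ.* a ℚ.- Dℚ ℚ.* (b ℚ.* b))) (ι-* d d) ⟩
    ι d ℚ.* ι d ℚ.* (a ℚ.* a ℚ.- Dℚ ℚ.* (b ℚ.* b))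
      ≡⟨ identity (ι d) Dℚ a b ⟩
    ι d ℚ.* a ℚ.* (ι d ℚ.* a) ℚ.- Dℚ ℚ.* (ι d ℚ.* b ℚ.* (ι d ℚ.* b))
      ≡⟨ cong₂ (λ u v → u ℚ.* u ℚ.- Dℚ ℚ.* (v ℚ.* v)) ≡p ≡r ⟩
    ι p ℚ.* ι p ℚ.- Dℚ ℚ.* (ι r ℚ.* ι r)
      ≡⟨ ι-norm p r ⟨
    ι (p ℤ.* p ℤ.- + D ℤ.* (r ℤ.* r)) ∎)
    where
    open ≡-Reasoning
    identity : ∀ d D a b → d ℚ.* d ℚ.* (a ℚ.* a ℚ.- D ℚ.* (b ℚ.* b))
             ≡ d ℚ.* a ℚ.* (d ℚ.* a) ℚ.- D ℚ.* (d ℚ.* b ℚ.* (d ℚ.* b))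
    identity = solve-∀ ringℚ
    ι-norm : ∀ p r → ι (p ℤ.* p ℤ.- + D ℤ.* (r ℤ.* r)) ≡ ι p ℚ.* ι p ℚ.- Dℚ ℚ.* (ι r ℚ.* ι r)
    ι-norm p r = trans (ι-+ (p ℤ.* p) (ℤ.- (+ D ℤ.* (r ℤ.* r)))) (cong₂ ℚ._+_ (ι-* p p)
      (trans (ι-neg (+ D ℤ.* (r ℤ.* r))) (cong ℚ.-_ (trans (ι-* (+ D) (r ℤ.* r)) (cong (Dℚ ℚ.*_) (ι-* r r))))))

  -- By multiplicativity d² clears every power of the rational number N(x).
  powers-cleared⇒norm-integer : ∀ d x → d ≢ 0ℤ → (∀ j → Cleared d (x ^ j)) → IsInteger (norm x)
  powers-cleared⇒norm-integer d x d≢0 cleared =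
    bounded-denominators⇒integer (norm x) (d ℤ.* d) (*-nonzero d≢0 d≢0)
      (λ j → subst (λ t → IsInteger (ι (d ℤ.* d) ℚ.* t)) (norm-^ x j) (cleared⇒norm-integer d (x ^ j) (cleared j)))

  -- Stands in for the integrality of x + 1. The induction runs over the mixed products (x + 1)^j
  -- x^i, where raising `j` is a single addition, so the same `d` works throughout.
  powers-cleared-+1 : ∀ d x → (∀ j → Cleared d (x ^ j)) → ∀ j → Cleared d ((x + 1K) ^ j)
  powers-cleared-+1 d x cleared j = subst (Cleared d) (*-identityʳ ((x + 1K) ^ j)) (mixed j 0)
    where
    split : ∀ y z → y * (x * z) + y * z ≡ (x + 1K) * y * z
    split y z = begin
      y * (x * z) + y * z      ≡⟨ cong (λ t → t + y * z) (*-assoc y x z) ⟨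
      y * x * z + y * z        ≡⟨ *-distribʳ-+ z (y * x) y ⟨
      (y * x + y) * z          ≡⟨ cong (_* z) (cong₂ _+_ (*-comm y x) (sym (*-identityˡ y))) ⟩
      (x * y + 1K * y) * z     ≡⟨ cong (_* z) (*-distribʳ-+ y x 1K) ⟨
      (x + 1K) * y * z         ∎
      where open ≡-Reasoning
    mixed : ∀ j i → Cleared d ((x + 1K) ^ j * x ^ i)
    mixed zero    i = subst (Cleared d) (sym (*-identityˡ (x ^ i))) (cleared i)
    mixed (suc j) i = subst (Cleared d) (split y (x ^ i))
      (cleared-+ d (y * x ^ suc i) (y * x ^ i) (mixed j (suc i)) (mixed j i))
      where y = (x + 1K) ^ j

  -- `t` is the trace and `n` the norm of `x`. The parities of `t` and `w` are constrained only
  -- through the last equation.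
  HalfIntegral : K → ℤ → ℤ → ℤ → Set
  HalfIntegral x t w n =
    ι (+ 2) ℚ.* re x ≡ ι t × ι (+ 2) ℚ.* im x ≡ ι w × t ℤ.* t ℤ.- + D ℤ.* (w ℤ.* w) ≡ + 4 ℤ.* n

  -- Once the trace t is an integer, D(2b)² = t² - 4n is one too, and squarefreeness of D makes 2b
  -- an integer.
  norms-integer⇒half-integral : Squarefree D → ∀ x n n′ → norm x ≡ ι n → norm (x + 1K) ≡ ι n′ →
                                ∃₂ λ t w → HalfIntegral x t w n
  norms-integer⇒half-integral sf x@(a +√D b) n n′ Nx≡n Nx+1≡n′ =
    t , w , trace , w≡ , ι-injective (t ℤ.* t ℤ.- + D ℤ.* (w ℤ.* w)) (+ 4 ℤ.* n) norm≡
    where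
    open ≡-Reasoning
    t = n′ ℤ.+ ℤ.- (n ℤ.+ 1ℤ)
    trace : ι (+ 2) ℚ.* a ≡ ι t
    trace = begin
      ι (+ 2) ℚ.* a                           ≡⟨ identity Dℚ a b ⟩
      norm (x + 1K) ℚ.+ ℚ.- (norm x ℚ.+ 1ℚ)   ≡⟨ cong₂ (λ u v → u ℚ.+ ℚ.- (v ℚ.+ 1ℚ)) Nx+1≡n′ Nx≡n ⟩
      ι n′ ℚ.+ ℚ.- (ι n ℚ.+ ι 1ℤ)             ≡⟨ cong (λ u → ι n′ ℚ.+ ℚ.- u) (ι-+ n 1ℤ) ⟨
      ι n′ ℚ.+ ℚ.- ι (n ℤ.+ 1ℤ)               ≡⟨ cong (ι n′ ℚ.+_) (ι-neg (n ℤ.+ 1ℤ)) ⟨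
      ι n′ ℚ.+ ι (ℤ.- (n ℤ.+ 1ℤ))             ≡⟨ ι-+ n′ (ℤ.- (n ℤ.+ 1ℤ)) ⟨
      ι t                                     ∎
      where
      identity : ∀ D a b → ι (+ 2) ℚ.* a ≡ (a ℚ.+ 1ℚ) ℚ.* (a ℚ.+ 1ℚ) ℚ.- D ℚ.* ((b ℚ.+ 0ℚ) ℚ.* (b ℚ.+ 0ℚ))
                                             ℚ.+ ℚ.- (a ℚ.* a ℚ.- D ℚ.* (b ℚ.* b) ℚ.+ 1ℚ)
      identity = solve-∀ ringℚ
    w² : ℚ
    w² = ι (+ 2) ℚ.* b ℚ.* (ι (+ 2) ℚ.* b)
    4Nx : ι (+ 2) ℚ.* a ℚ.* (ι (+ 2) ℚ.* a) ℚ.- Dℚ ℚ.* w² ≡ ι (+ 4) ℚ.* norm x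
    4Nx = identity Dℚ a b
      where
      identity : ∀ D a b → ι (+ 2) ℚ.* a ℚ.* (ι (+ 2) ℚ.* a) ℚ.- D ℚ.* (ι (+ 2) ℚ.* b ℚ.* (ι (+ 2) ℚ.* b))
               ≡ ι (+ 4) ℚ.* (a ℚ.* a ℚ.- D ℚ.* (b ℚ.* b))
      identity = solve-∀ ringℚ
    norm-half : ι (t ℤ.* t) ℚ.- Dℚ ℚ.* w² ≡ ι (+ 4 ℤ.* n)
    norm-half = begin
      ι (t ℤ.* t) ℚ.- Dℚ ℚ.* w²                               ≡⟨ cong (λ u → u ℚ.- Dℚ ℚ.* w²) (ι-* t t) ⟩
      ι t ℚ.* ι t ℚ.- Dℚ ℚ.* w²                               ≡⟨ cong (λ u → u ℚ.* u ℚ.- Dℚ ℚ.* w²) trace ⟨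
      ι (+ 2) ℚ.* a ℚ.* (ι (+ 2) ℚ.* a) ℚ.- Dℚ ℚ.* w²         ≡⟨ 4Nx ⟩
      ι (+ 4) ℚ.* norm x                                      ≡⟨ cong (ι (+ 4) ℚ.*_) Nx≡n ⟩
      ι (+ 4) ℚ.* ι n                                         ≡⟨ ι-* (+ 4) n ⟨
      ι (+ 4 ℤ.* n)                                           ∎
    complement : ∀ u v z → u ℚ.- v ≡ z → v ≡ u ℚ.+ ℚ.- z
    complement u v z refl = identity u v
      where
      identity : ∀ u v → v ≡ u ℚ.+ ℚ.- (u ℚ.+ ℚ.- v)
      identity = solve-∀ ringℚ
    Dw² : Dℚ ℚ.* w² ≡ ι (t ℤ.* t ℤ.+ ℤ.- (+ 4 ℤ.* n))
    Dw² = begin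
      Dℚ ℚ.* w²                                ≡⟨ complement (ι (t ℤ.* t)) (Dℚ ℚ.* w²) (ι (+ 4 ℤ.* n)) norm-half ⟩
      ι (t ℤ.* t) ℚ.+ ℚ.- ι (+ 4 ℤ.* n)        ≡⟨ cong (ι (t ℤ.* t) ℚ.+_) (ι-neg (+ 4 ℤ.* n)) ⟨
      ι (t ℤ.* t) ℚ.+ ι (ℤ.- (+ 4 ℤ.* n))      ≡⟨ ι-+ (t ℤ.* t) (ℤ.- (+ 4 ℤ.* n)) ⟨
      ι (t ℤ.* t ℤ.+ ℤ.- (+ 4 ℤ.* n))          ∎
    2b∈ℤ : IsInteger (ι (+ 2) ℚ.* b)
    2b∈ℤ = squarefree⇒integer sf (ι (+ 2) ℚ.* b) (t ℤ.* t ℤ.+ ℤ.- (+ 4 ℤ.* n) , Dw²)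
    w = proj₁ 2b∈ℤ
    w≡ = proj₂ 2b∈ℤ
    norm≡ : ι (t ℤ.* t ℤ.- + D ℤ.* (w ℤ.* w)) ≡ ι (+ 4 ℤ.* n)
    norm≡ = begin
      ι (t ℤ.* t ℤ.- + D ℤ.* (w ℤ.* w))        ≡⟨ ι-+ (t ℤ.* t) (ℤ.- (+ D ℤ.* (w ℤ.* w))) ⟩
      ι (t ℤ.* t) ℚ.+ ι (ℤ.- (+ D ℤ.* (w ℤ.* w)))
        ≡⟨ cong (ι (t ℤ.* t) ℚ.+_) (ι-neg (+ D ℤ.* (w ℤ.* w))) ⟩
      ι (t ℤ.* t) ℚ.- ι (+ D ℤ.* (w ℤ.* w))    ≡⟨ cong (λ u → ι (t ℤ.* t) ℚ.- u) (ι-* (+ D) (w ℤ.* w)) ⟩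
      ι (t ℤ.* t) ℚ.- Dℚ ℚ.* ι (w ℤ.* w)       ≡⟨ cong (λ u → ι (t ℤ.* t) ℚ.- Dℚ ℚ.* u) (ι-* w w) ⟩
      ι (t ℤ.* t) ℚ.- Dℚ ℚ.* (ι w ℚ.* ι w)     ≡⟨ cong (λ u → ι (t ℤ.* t) ℚ.- Dℚ ℚ.* (u ℚ.* u)) w≡ ⟨
      ι (t ℤ.* t) ℚ.- Dℚ ℚ.* w²                ≡⟨ norm-half ⟩
      ι (+ 4 ℤ.* n)                            ∎

  -- Both x and x + 1 have integral norms, and these differ by 1 + Tr x.
  integral⇒half-integral : Squarefree D → ∀ x → IsIntegral x → ∃[ t ] ∃₂ λ w n → HalfIntegral x t w n
  integral⇒half-integral sf x x∈O =
    let d , d≢0 , cleared = integral⇒powers-cleared x x∈O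
        n  , Nx≡n         = powers-cleared⇒norm-integer d x d≢0 cleared
        n′ , Nx+1≡n′      = powers-cleared⇒norm-integer d (x + 1K) d≢0 (powers-cleared-+1 d x cleared)
        t , w , half      = norms-integer⇒half-integral sf x n n′ Nx≡n Nx+1≡n′
    in t , w , n , half

-- Principal ideals

prime∤⇒∣-cancelˡ : ∀ {p m n} → Prime p → p ∤ m → p ∣ m ℕ.* n → p ∣ n
prime∤⇒∣-cancelˡ {m = m} {n} pp p∤m p∣mn with euclidsLemma m n pp p∣mn
... | inj₁ p∣m = ⊥-elim (p∤m p∣m)
... | inj₂ p∣n = p∣n

-- Arithmetic of ℤ[θ], θ² = τθ + ν, in integer coordinates

module QuadraticOrder (τ ν : ℤ) where

  infixl 7 _⊗_
  infixl 6 _⊕_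
  _⊗_ _⊕_ : ℤ × ℤ → ℤ × ℤ → ℤ × ℤ
  (a , b) ⊗ (c , d) = a ℤ.* c ℤ.+ ν ℤ.* (b ℤ.* d) , a ℤ.* d ℤ.+ b ℤ.* c ℤ.+ τ ℤ.* (b ℤ.* d)
  (a , b) ⊕ (c , d) = a ℤ.+ c , b ℤ.+ d

  conj : ℤ × ℤ → ℤ × ℤ
  conj (a , b) = a ℤ.+ τ ℤ.* b , ℤ.- b

  norm : ℤ × ℤ → ℤ
  norm (a , b) = a ℤ.* a ℤ.+ τ ℤ.* (a ℤ.* b) ℤ.- ν ℤ.* (b ℤ.* b)

  norm-⊗ : ∀ x y → norm (x ⊗ y) ≡ norm x ℤ.* norm y
  norm-⊗ (a , b) (c , d) = identity τ ν a b c d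
    where
    identity : ∀ τ ν a b c d →
      (a ℤ.* c ℤ.+ ν ℤ.* (b ℤ.* d)) ℤ.* (a ℤ.* c ℤ.+ ν ℤ.* (b ℤ.* d))
      ℤ.+ τ ℤ.* ((a ℤ.* c ℤ.+ ν ℤ.* (b ℤ.* d)) ℤ.* (a ℤ.* d ℤ.+ b ℤ.* c ℤ.+ τ ℤ.* (b ℤ.* d)))
      ℤ.- ν ℤ.* ((a ℤ.* d ℤ.+ b ℤ.* c ℤ.+ τ ℤ.* (b ℤ.* d)) ℤ.* (a ℤ.* d ℤ.+ b ℤ.* c ℤ.+ τ ℤ.* (b ℤ.* d)))
      ≡ (a ℤ.* a ℤ.+ τ ℤ.* (a ℤ.* b) ℤ.- ν ℤ.* (b ℤ.* b)) ℤ.* (c ℤ.* c ℤ.+ τ ℤ.* (c ℤ.* d) ℤ.- ν ℤ.* (d ℤ.* d))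
    identity = solve-∀ ringℤ

  -- Every term of the expansion other than N(c) carries a factor p. The witness is read off from
  -- `identity`.
  norm-⊕ : ∀ p x c → ∃[ k ] norm (x ⊗ (p , 0ℤ) ⊕ c) ≡ p ℤ.* k ℤ.+ norm c
  norm-⊕ p (a , b) (c , d) = _ , identity τ ν p a b c d
    where
    identity : ∀ τ ν p a b c d → let
        u = a ℤ.* p ℤ.+ ν ℤ.* (b ℤ.* 0ℤ) ℤ.+ c
        v = a ℤ.* 0ℤ ℤ.+ b ℤ.* p ℤ.+ τ ℤ.* (b ℤ.* 0ℤ) ℤ.+ d
      in u ℤ.* u ℤ.+ τ ℤ.* (u ℤ.* v) ℤ.- ν ℤ.* (v ℤ.* v)
      ≡ p ℤ.* (p ℤ.* (a ℤ.* a ℤ.+ τ ℤ.* (a ℤ.* b) ℤ.- ν ℤ.* (b ℤ.* b))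
               ℤ.+ (a ℤ.* c ℤ.+ a ℤ.* c ℤ.+ τ ℤ.* (a ℤ.* d ℤ.+ b ℤ.* c) ℤ.- ν ℤ.* (b ℤ.* d ℤ.+ b ℤ.* d)))
        ℤ.+ (c ℤ.* c ℤ.+ τ ℤ.* (c ℤ.* d) ℤ.- ν ℤ.* (d ℤ.* d))
    identity = solve-∀ ringℤ

  norm-rational : ∀ p → norm (p , 0ℤ) ≡ p ℤ.* p
  norm-rational p = identity τ ν p
    where
    identity : ∀ τ ν p → p ℤ.* p ℤ.+ τ ℤ.* (p ℤ.* 0ℤ) ℤ.- ν ℤ.* (0ℤ ℤ.* 0ℤ) ≡ p ℤ.* p
    identity = solve-∀ ringℤ

  im-scaled : ∀ s x → proj₂ ((s , 0ℤ) ⊗ x) ≡ s ℤ.* proj₂ x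
  im-scaled s (a , b) = identity τ s a b
    where
    identity : ∀ τ s a b → s ℤ.* b ℤ.+ 0ℤ ℤ.* a ℤ.+ τ ℤ.* (0ℤ ℤ.* b) ≡ s ℤ.* b
    identity = solve-∀ ringℤ

  -- From N(u) = u · conj u. Only θ-coordinates are compared, because that of κ is 1 and so detects
  -- divisibility by p.
  norm-im : ∀ x u v → norm u ℤ.* proj₂ (x ⊗ v) ≡ proj₂ (x ⊗ u ⊗ (conj u ⊗ v))
  norm-im (a , b) (c , d) (e , f) = identity τ ν a b c d e f
    where
    identity : ∀ τ ν a b c d e f → let
        g = a ℤ.* c ℤ.+ ν ℤ.* (b ℤ.* d)
        h = a ℤ.* d ℤ.+ b ℤ.* c ℤ.+ τ ℤ.* (b ℤ.* d)
        c′ = c ℤ.+ τ ℤ.* d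
        d′ = ℤ.- d
        g′ = c′ ℤ.* e ℤ.+ ν ℤ.* (d′ ℤ.* f)
        h′ = c′ ℤ.* f ℤ.+ d′ ℤ.* e ℤ.+ τ ℤ.* (d′ ℤ.* f)
      in (c ℤ.* c ℤ.+ τ ℤ.* (c ℤ.* d) ℤ.- ν ℤ.* (d ℤ.* d)) ℤ.* (a ℤ.* f ℤ.+ b ℤ.* e ℤ.+ τ ℤ.* (b ℤ.* f))
      ≡ g ℤ.* h′ ℤ.+ h ℤ.* g′ ℤ.+ τ ℤ.* (h ℤ.* h′)
    identity = solve-∀ ringℤ

  im-scaled₂ : ∀ s p x → proj₂ ((s , 0ℤ) ⊗ (p , 0ℤ) ⊗ x) ≡ s ℤ.* p ℤ.* proj₂ x
  im-scaled₂ s p (a , b) = identity τ ν s p a b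
    where
    identity : ∀ τ ν s p a b → let
        g = s ℤ.* p ℤ.+ ν ℤ.* (0ℤ ℤ.* 0ℤ)
        h = s ℤ.* 0ℤ ℤ.+ 0ℤ ℤ.* p ℤ.+ τ ℤ.* (0ℤ ℤ.* 0ℤ)
      in g ℤ.* b ℤ.+ h ℤ.* a ℤ.+ τ ℤ.* (h ℤ.* b) ≡ s ℤ.* p ℤ.* b
    identity = solve-∀ ringℤ

  -- s is a square clearing denominators.  Since x lies in (p, κ) and p divides N(κ),
  -- p divides N(x); since x divides κ and p does not, p also divides N(u).
  generator-norm : ∀ {p} → Prime p → ∀ s κ₀ e x a b u v nu → p ∤ ∣ s ∣ →
    norm (κ₀ , 1ℤ) ≡ + p ℤ.* e →
    x ≡ a ⊗ (+ p , 0ℤ) ⊕ b ⊗ (κ₀ , 1ℤ) →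
    x ⊗ u ≡ (s , 0ℤ) ⊗ (+ p , 0ℤ) →
    x ⊗ v ≡ (s , 0ℤ) ⊗ (κ₀ , 1ℤ) →
    norm u ≡ s ℤ.* nu → ∃[ c ] c ∣ ∣ s ∣ × ∣ norm x ∣ ≡ c ℕ.* p
  generator-norm {p} pp s κ₀ e x a b u v nu p∤s Nκ≡ x≡ xu≡ xv≡ Nu≡ = c , divides d (trans (sym dc≡s) (ℕ.*-comm c d)) , Nx≡cp
    where
    open ≡-Reasoning
    κ = κ₀ , 1ℤ
    k = proj₁ (norm-⊕ (+ p) a (b ⊗ κ))
    c = ∣ k ℤ.+ norm b ℤ.* e ∣
    w = proj₂ (conj u ⊗ v)
    instance
      _ = prime⇒nonZero pp
      s-nonZero : NonZero ∣ s ∣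
      s-nonZero = ℕ.≢-nonZero (λ ∣s∣≡0 → p∤s (subst (p ∣_) (sym ∣s∣≡0) (p ∣.∣0)))

    Nx≡ : norm x ≡ (k ℤ.+ norm b ℤ.* e) ℤ.* + p
    Nx≡ = begin
      norm x                                         ≡⟨ cong norm x≡ ⟩
      norm (a ⊗ (+ p , 0ℤ) ⊕ b ⊗ κ)                  ≡⟨ proj₂ (norm-⊕ (+ p) a (b ⊗ κ)) ⟩
      + p ℤ.* k ℤ.+ norm (b ⊗ κ)                     ≡⟨ cong (λ t → + p ℤ.* k ℤ.+ t) (norm-⊗ b κ) ⟩
      + p ℤ.* k ℤ.+ norm b ℤ.* norm κ                ≡⟨ cong (λ t → + p ℤ.* k ℤ.+ norm b ℤ.* t) Nκ≡ ⟩
      + p ℤ.* k ℤ.+ norm b ℤ.* (+ p ℤ.* e)           ≡⟨ identity (+ p) k (norm b) e ⟩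
      (k ℤ.+ norm b ℤ.* e) ℤ.* + p                   ∎
      where
      identity : ∀ p k n e → p ℤ.* k ℤ.+ n ℤ.* (p ℤ.* e) ≡ (k ℤ.+ n ℤ.* e) ℤ.* p
      identity = solve-∀ ringℤ

    Nx≡cp : ∣ norm x ∣ ≡ c ℕ.* p
    Nx≡cp = trans (cong ∣_∣ Nx≡) (ℤ.abs-* (k ℤ.+ norm b ℤ.* e) (+ p))

    -- Substituting xv = sκ and xu = sp into `norm-im` gives s² · nu = s · w · p, and p is prime to
    -- s.
    p∣nu : p ∣ ∣ nu ∣
    p∣nu = prime∤⇒∣-cancelˡ pp p∤s (prime∤⇒∣-cancelˡ pp p∤s (divides (∣ s ∣ ℕ.* ∣ w ∣) (begin
      ∣ s ∣ ℕ.* (∣ s ∣ ℕ.* ∣ nu ∣)          ≡⟨ cong (∣ s ∣ ℕ.*_) (ℤ.abs-* s nu) ⟨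
      ∣ s ∣ ℕ.* ∣ s ℤ.* nu ∣                ≡⟨ ℤ.abs-* s (s ℤ.* nu) ⟨
      ∣ s ℤ.* (s ℤ.* nu) ∣                  ≡⟨ cong ∣_∣ ims ⟩
      ∣ s ℤ.* w ℤ.* + p ∣                   ≡⟨ ℤ.abs-* (s ℤ.* w) (+ p) ⟩
      ∣ s ℤ.* w ∣ ℕ.* p                     ≡⟨ cong (ℕ._* p) (ℤ.abs-* s w) ⟩
      ∣ s ∣ ℕ.* ∣ w ∣ ℕ.* p                 ∎)))
      where
      swap : ∀ s p w → s ℤ.* p ℤ.* w ≡ s ℤ.* w ℤ.* p
      swap = solve-∀ ringℤ
      ims : s ℤ.* (s ℤ.* nu) ≡ s ℤ.* w ℤ.* + p
      ims = begin
        s ℤ.* (s ℤ.* nu)                                     ≡⟨ ℤ.*-comm s (s ℤ.* nu) ⟩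
        s ℤ.* nu ℤ.* s                                       ≡⟨ cong₂ ℤ._*_ Nu≡ (ℤ.*-identityʳ s) ⟨
        norm u ℤ.* (s ℤ.* 1ℤ)                                ≡⟨ cong (norm u ℤ.*_) (im-scaled s κ) ⟨
        norm u ℤ.* proj₂ ((s , 0ℤ) ⊗ κ)                      ≡⟨ cong (λ t → norm u ℤ.* proj₂ t) xv≡ ⟨
        norm u ℤ.* proj₂ (x ⊗ v)                             ≡⟨ norm-im x u v ⟩
        proj₂ (x ⊗ u ⊗ (conj u ⊗ v))                         ≡⟨ cong (λ t → proj₂ (t ⊗ (conj u ⊗ v))) xu≡ ⟩
        proj₂ ((s , 0ℤ) ⊗ (+ p , 0ℤ) ⊗ (conj u ⊗ v))         ≡⟨ im-scaled₂ s (+ p) (conj u ⊗ v) ⟩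
        s ℤ.* + p ℤ.* w                                      ≡⟨ swap s (+ p) w ⟩
        s ℤ.* w ℤ.* + p                                      ∎

    d = quotient p∣nu

    -- With N(x) = ±cp and nu = ±dp, the equation N(x)N(u) = s²p² reduces to cd = |s|.
    dc≡s : c ℕ.* d ≡ ∣ s ∣
    dc≡s = ℕ.*-cancelˡ-≡ (c ℕ.* d) ∣ s ∣ (∣ s ∣ ℕ.* (p ℕ.* p)) {{ℕ.m*n≢0 ∣ s ∣ (p ℕ.* p) {{s-nonZero}} {{ℕ.m*n≢0 p p}}}} (begin
      ∣ s ∣ ℕ.* (p ℕ.* p) ℕ.* (c ℕ.* d)             ≡⟨ regroup ∣ s ∣ p c d ⟩
      c ℕ.* p ℕ.* (∣ s ∣ ℕ.* (d ℕ.* p))             ≡⟨ cong₂ (λ t r → t ℕ.* (∣ s ∣ ℕ.* r)) Nx≡cp (_∣_.equality p∣nu) ⟨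
      ∣ norm x ∣ ℕ.* (∣ s ∣ ℕ.* ∣ nu ∣)             ≡⟨ cong (∣ norm x ∣ ℕ.*_) (ℤ.abs-* s nu) ⟨
      ∣ norm x ∣ ℕ.* ∣ s ℤ.* nu ∣                   ≡⟨ ℤ.abs-* (norm x) (s ℤ.* nu) ⟨
      ∣ norm x ℤ.* (s ℤ.* nu) ∣                     ≡⟨ cong ∣_∣ norms ⟩
      ∣ s ℤ.* s ℤ.* (+ p ℤ.* + p) ∣                 ≡⟨ ℤ.abs-* (s ℤ.* s) (+ p ℤ.* + p) ⟩
      ∣ s ℤ.* s ∣ ℕ.* ∣ + p ℤ.* + p ∣               ≡⟨ cong₂ ℕ._*_ (ℤ.abs-* s s) (ℤ.abs-* (+ p) (+ p)) ⟩
      ∣ s ∣ ℕ.* ∣ s ∣ ℕ.* (p ℕ.* p)                 ≡⟨ regroup′ ∣ s ∣ (p ℕ.* p) ⟩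
      ∣ s ∣ ℕ.* (p ℕ.* p) ℕ.* ∣ s ∣                 ∎)
      where
      regroup : ∀ s p c d → s ℕ.* (p ℕ.* p) ℕ.* (c ℕ.* d) ≡ c ℕ.* p ℕ.* (s ℕ.* (d ℕ.* p))
      regroup = ℕ-Solver.solve-∀
      regroup′ : ∀ s p → s ℕ.* s ℕ.* p ≡ s ℕ.* p ℕ.* s
      regroup′ = ℕ-Solver.solve-∀
      norms : norm x ℤ.* (s ℤ.* nu) ≡ s ℤ.* s ℤ.* (+ p ℤ.* + p)
      norms = begin
        norm x ℤ.* (s ℤ.* nu)                      ≡⟨ cong (norm x ℤ.*_) Nu≡ ⟨
        norm x ℤ.* norm u                          ≡⟨ norm-⊗ x u ⟨
        norm (x ⊗ u)                               ≡⟨ cong norm xu≡ ⟩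
        norm ((s , 0ℤ) ⊗ (+ p , 0ℤ))               ≡⟨ norm-⊗ (s , 0ℤ) (+ p , 0ℤ) ⟩
        norm (s , 0ℤ) ℤ.* norm (+ p , 0ℤ)          ≡⟨ cong₂ ℤ._*_ (norm-rational s) (norm-rational (+ p)) ⟩
        s ℤ.* s ℤ.* (+ p ℤ.* + p)                  ∎

-- Ideal classes and generators of principal ideals

module ClassNumber (D : ℕ) where
  open Field D hiding (IsClassNumber)

  1∈𝒪 : IsIntegral 1K
  1∈𝒪 = -1ℤ ∷ [] , trans (cong (λ t → fromℤ -1ℤ + t) (*-identityˡ 1K)) refl

  0∈𝒪 : IsIntegral 0K
  0∈𝒪 = 0ℤ ∷ [] , trans (cong (λ t → fromℤ 0ℤ + t) (*-identityʳ 0K)) refl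

  +-identityʳ : ∀ x → x + 0K ≡ x
  +-identityʳ (a +√D b) = cong₂ _+√D_ (ℚ.+-identityʳ a) (ℚ.+-identityʳ b)

  +-identityˡ : ∀ x → 0K + x ≡ x
  +-identityˡ (a +√D b) = cong₂ _+√D_ (ℚ.+-identityˡ a) (ℚ.+-identityˡ b)

  unitIdeal : FractionalIdeal
  unitIdeal = record { generators = 1K ∷ [] ; nonzero = here λ () }

  1∈unitIdeal : 1K ∈ unitIdeal
  1∈unitIdeal = 1K , 0K , 1∈𝒪 , refl , sym (trans (+-identityʳ (1K * 1K)) (*-identityˡ 1K))

  ∈unitIdeal⇒integral : ∀ x → x ∈ unitIdeal → IsIntegral x
  ∈unitIdeal⇒integral x (a , y , a∈𝒪 , y≡0 , x≡) = subst IsIntegral (sym (begin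
    x              ≡⟨ x≡ ⟩
    a * 1K + y     ≡⟨ cong₂ _+_ (*-identityʳ a) y≡0 ⟩
    a + 0K         ≡⟨ +-identityʳ a ⟩
    a              ∎)) a∈𝒪
    where open ≡-Reasoning

  -- If I = cF and 𝒪 = c′F, the generator is c/c′. No inverse is taken: 1 = c′f for some f in F, so
  -- ξ = cf, and cx = ξ(c′x) with c′x in 𝒪.
  common-class⇒principal : ∀ F I → F ∼ I → F ∼ unitIdeal →
    ∃[ ξ ] ξ ∈ I × (∀ y → y ∈ I → ∃[ a ] IsIntegral a × y ≡ ξ * a)
  common-class⇒principal F I (c , _ , I⇔cF) (c′ , _ , 𝒪⇔c′F) =
    let f , f∈F , 1≡c′f = Equivalence.to (𝒪⇔c′F 1K) 1∈unitIdeal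
    in c * f , Equivalence.from (I⇔cF (c * f)) (f , f∈F , refl) , λ y y∈I →
      let x , x∈F , y≡cx = Equivalence.to (I⇔cF y) y∈I
      in c′ * x , ∈unitIdeal⇒integral (c′ * x) (Equivalence.from (𝒪⇔c′F (c′ * x)) (x , x∈F , refl)) , (begin
        y                        ≡⟨ y≡cx ⟩
        c * x                    ≡⟨ *-identityʳ (c * x) ⟨
        c * x * 1K               ≡⟨ cong (c * x *_) 1≡c′f ⟩
        c * x * (c′ * f)         ≡⟨ cong (c * x *_) (*-comm c′ f) ⟩
        c * x * (f * c′)         ≡⟨ *-assoc (c * x) f c′ ⟨
        c * x * f * c′           ≡⟨ cong (_* c′) (*-assoc c x f) ⟩
        c * (x * f) * c′         ≡⟨ cong (λ t → c * t * c′) (*-comm x f) ⟩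
        c * (f * x) * c′         ≡⟨ cong (_* c′) (*-assoc c f x) ⟨
        c * f * x * c′           ≡⟨ *-assoc (c * f) x c′ ⟩
        c * f * (x * c′)         ≡⟨ cong (c * f *_) (*-comm x c′) ⟩
        c * f * (c′ * x)         ∎)
    where open ≡-Reasoning

  classNumber≤1⇒principal : ∀ h → IsClassNumber D h → ¬ h ℕ.> 1 → ∀ I →
    ∃[ ξ ] ξ ∈ I × (∀ y → y ∈ I → ∃[ a ] IsIntegral a × y ≡ ξ * a)
  classNumber≤1⇒principal zero (f , _ , surj) _ I with proj₁ (surj I)
  ... | ()
  classNumber≤1⇒principal (suc zero) (f , _ , surj) _ I =
    common-class⇒principal (f zero) I (hit I) (hit unitIdeal)
    where
    only : ∀ (i : Fin 1) → zero ≡ i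
    only zero = refl
    hit : ∀ J → f zero ∼ J
    hit J = proj₂ (surj J) (only (proj₁ (surj J)))
  classNumber≤1⇒principal (suc (suc _)) _ h≯1 I = ⊥-elim (h≯1 (s≤s (s≤s z≤n)))

  two-generated⇒principal : ∀ h → IsClassNumber D h → ¬ h ℕ.> 1 → ∀ g κ → g ≢ 0K →
    ∃[ ξ ] ∃₂ λ a b → ∃₂ λ u v → IsIntegral a × IsIntegral b × IsIntegral u × IsIntegral v ×
      ξ ≡ a * g + b * κ × g ≡ ξ * u × κ ≡ ξ * v
  two-generated⇒principal h hD h≯1 g κ g≢0 =
    let ξ , (a , y , a∈𝒪 , (b , z , b∈𝒪 , z≡0 , y≡) , ξ≡) , divisor = classNumber≤1⇒principal h hD h≯1 I
        u , u∈𝒪 , g≡ξu = divisor g g∈I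
        v , v∈𝒪 , κ≡ξv = divisor κ κ∈I
    in ξ , a , b , u , v , a∈𝒪 , b∈𝒪 , u∈𝒪 , v∈𝒪 ,
       trans ξ≡ (cong (λ t → a * g + t) (trans y≡ (trans (cong (λ t → b * κ + t) z≡0) (+-identityʳ (b * κ))))) ,
       g≡ξu , κ≡ξv
    where
    I : FractionalIdeal
    I = record { generators = g ∷ κ ∷ [] ; nonzero = here g≢0 }
    0∙ : ∀ x → 0K * x ≡ 0K
    0∙ x = trans (*-comm 0K x) (*-zeroʳ x)
    κ∈span : κ ∈Span (κ ∷ [])
    κ∈span = 1K , 0K , 1∈𝒪 , refl , sym (trans (+-identityʳ (1K * κ)) (*-identityˡ κ))
    0∈span : 0K ∈Span (κ ∷ [])
    0∈span = 0K , 0K , 0∈𝒪 , refl , sym (trans (+-identityʳ (0K * κ)) (0∙ κ))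
    g∈I : g ∈ I
    g∈I = 1K , 0K , 1∈𝒪 , 0∈span , sym (trans (+-identityʳ (1K * g)) (*-identityˡ g))
    κ∈I : κ ∈ I
    κ∈I = 0K , κ , 0∈𝒪 , κ∈span , sym (trans (cong (_+ κ) (0∙ g)) (+-identityˡ κ))

  -- The order ℤ[θ], where θ = θ₀ + θ₁√D is a root of X² − τX − ν.
  module Order (τ ν : ℤ) (θ₀ θ₁ θ₁⁻¹ : ℚ) (inverse : θ₁ ℚ.* θ₁⁻¹ ≡ 1ℚ)
    (θ²-re : θ₀ ℚ.* θ₀ ℚ.+ Dℚ ℚ.* (θ₁ ℚ.* θ₁) ≡ ι τ ℚ.* θ₀ ℚ.+ ι ν)
    (θ²-im : θ₀ ℚ.* θ₁ ℚ.+ θ₁ ℚ.* θ₀ ≡ ι τ ℚ.* θ₁) where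

    open QuadraticOrder τ ν public using (_⊗_; _⊕_) renaming (norm to norm′; generator-norm to generator-norm′)

    embed : ℤ × ℤ → K
    embed (a , b) = (ι a ℚ.+ ι b ℚ.* θ₀) +√D (ι b ℚ.* θ₁)

    embed-injective : ∀ x y → embed x ≡ embed y → x ≡ y
    embed-injective (a , b) (c , d) eq = cong₂ _,_ (ι-injective a c ιa≡ιc) b≡d
      where
      open ≡-Reasoning
      cancel-θ₁ : ∀ z → ι z ≡ ι z ℚ.* θ₁ ℚ.* θ₁⁻¹
      cancel-θ₁ z = sym (trans (ℚ.*-assoc (ι z) θ₁ θ₁⁻¹) (trans (cong (ι z ℚ.*_) inverse) (ℚ.*-identityʳ (ι z))))
      b≡d : b ≡ d
      b≡d = ι-injective b d (trans (cancel-θ₁ b) (trans (cong (λ t → im t ℚ.* θ₁⁻¹) eq) (sym (cancel-θ₁ d))))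
      identity : ∀ a b → a ≡ a ℚ.+ b ℚ.- b
      identity = solve-∀ ringℚ
      ιa≡ιc : ι a ≡ ι c
      ιa≡ιc = begin
        ι a                                             ≡⟨ identity (ι a) (ι b ℚ.* θ₀) ⟩
        ι a ℚ.+ ι b ℚ.* θ₀ ℚ.- ι b ℚ.* θ₀               ≡⟨ cong₂ (λ t z → re t ℚ.- ι z ℚ.* θ₀) eq b≡d ⟩
        ι c ℚ.+ ι d ℚ.* θ₀ ℚ.- ι d ℚ.* θ₀               ≡⟨ identity (ι c) (ι d ℚ.* θ₀) ⟨
        ι c                                             ∎

    embed-⊕ : ∀ x y → embed (x ⊕ y) ≡ embed x + embed y
    embed-⊕ (a , b) (c , d) = cong₂ _+√D_
      (trans (cong₂ (λ s t → s ℚ.+ t ℚ.* θ₀) (ι-+ a c) (ι-+ b d)) (rational (ι a) (ι b) (ι c) (ι d) θ₀))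
      (trans (cong (ℚ._* θ₁) (ι-+ b d)) (ℚ.*-distribʳ-+ θ₁ (ι b) (ι d)))
      where
      rational : ∀ a b c d θ → a ℚ.+ c ℚ.+ (b ℚ.+ d) ℚ.* θ ≡ a ℚ.+ b ℚ.* θ ℚ.+ (c ℚ.+ d ℚ.* θ)
      rational = solve-∀ ringℚ

    embed-⊗ : ∀ x y → embed (x ⊗ y) ≡ embed x * embed y
    embed-⊗ (a , b) (c , d) = cong₂ _+√D_
      (begin
        ι re′ ℚ.+ ι im′ ℚ.* θ₀
          ≡⟨ cong₂ (λ s t → s ℚ.+ t ℚ.* θ₀) ι-re′ ι-im′ ⟩
        ι a ℚ.* ι c ℚ.+ ι ν ℚ.* (ι b ℚ.* ι d) ℚ.+ (ι a ℚ.* ι d ℚ.+ ι b ℚ.* ι c ℚ.+ ι τ ℚ.* (ι b ℚ.* ι d)) ℚ.* θ₀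
          ≡⟨ rational₁ (ι a) (ι b) (ι c) (ι d) (ι τ) (ι ν) θ₀ ⟩
        ι a ℚ.* ι c ℚ.+ (ι a ℚ.* ι d ℚ.+ ι b ℚ.* ι c) ℚ.* θ₀ ℚ.+ ι b ℚ.* ι d ℚ.* (ι τ ℚ.* θ₀ ℚ.+ ι ν)
          ≡⟨ cong (λ t → ι a ℚ.* ι c ℚ.+ (ι a ℚ.* ι d ℚ.+ ι b ℚ.* ι c) ℚ.* θ₀ ℚ.+ ι b ℚ.* ι d ℚ.* t) θ²-re ⟨
        ι a ℚ.* ι c ℚ.+ (ι a ℚ.* ι d ℚ.+ ι b ℚ.* ι c) ℚ.* θ₀
            ℚ.+ ι b ℚ.* ι d ℚ.* (θ₀ ℚ.* θ₀ ℚ.+ Dℚ ℚ.* (θ₁ ℚ.* θ₁))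
          ≡⟨ rational₂ (ι a) (ι b) (ι c) (ι d) Dℚ θ₀ θ₁ ⟩
        (ι a ℚ.+ ι b ℚ.* θ₀) ℚ.* (ι c ℚ.+ ι d ℚ.* θ₀) ℚ.+ Dℚ ℚ.* (ι b ℚ.* θ₁ ℚ.* (ι d ℚ.* θ₁)) ∎)
      (begin
        ι im′ ℚ.* θ₁
          ≡⟨ cong (ℚ._* θ₁) ι-im′ ⟩
        (ι a ℚ.* ι d ℚ.+ ι b ℚ.* ι c ℚ.+ ι τ ℚ.* (ι b ℚ.* ι d)) ℚ.* θ₁
          ≡⟨ irrational₁ (ι a) (ι b) (ι c) (ι d) (ι τ) θ₁ ⟩
        (ι a ℚ.* ι d ℚ.+ ι b ℚ.* ι c) ℚ.* θ₁ ℚ.+ ι b ℚ.* ι d ℚ.* (ι τ ℚ.* θ₁)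
          ≡⟨ cong (λ t → (ι a ℚ.* ι d ℚ.+ ι b ℚ.* ι c) ℚ.* θ₁ ℚ.+ ι b ℚ.* ι d ℚ.* t) θ²-im ⟨
        (ι a ℚ.* ι d ℚ.+ ι b ℚ.* ι c) ℚ.* θ₁ ℚ.+ ι b ℚ.* ι d ℚ.* (θ₀ ℚ.* θ₁ ℚ.+ θ₁ ℚ.* θ₀)
          ≡⟨ irrational₂ (ι a) (ι b) (ι c) (ι d) θ₀ θ₁ ⟩
        (ι a ℚ.+ ι b ℚ.* θ₀) ℚ.* (ι d ℚ.* θ₁) ℚ.+ ι b ℚ.* θ₁ ℚ.* (ι c ℚ.+ ι d ℚ.* θ₀) ∎)
      where
      open ≡-Reasoning
      re′ = a ℤ.* c ℤ.+ ν ℤ.* (b ℤ.* d)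
      im′ = a ℤ.* d ℤ.+ b ℤ.* c ℤ.+ τ ℤ.* (b ℤ.* d)
      ι-*₃ : ∀ x y z → ι (x ℤ.* (y ℤ.* z)) ≡ ι x ℚ.* (ι y ℚ.* ι z)
      ι-*₃ x y z = trans (ι-* x (y ℤ.* z)) (cong (ι x ℚ.*_) (ι-* y z))
      ι-re′ : ι re′ ≡ ι a ℚ.* ι c ℚ.+ ι ν ℚ.* (ι b ℚ.* ι d)
      ι-re′ = trans (ι-+ (a ℤ.* c) (ν ℤ.* (b ℤ.* d))) (cong₂ ℚ._+_ (ι-* a c) (ι-*₃ ν b d))
      ι-im′ : ι im′ ≡ ι a ℚ.* ι d ℚ.+ ι b ℚ.* ι c ℚ.+ ι τ ℚ.* (ι b ℚ.* ι d)
      ι-im′ = trans (ι-+ (a ℤ.* d ℤ.+ b ℤ.* c) (τ ℤ.* (b ℤ.* d))) (cong₂ ℚ._+_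
        (trans (ι-+ (a ℤ.* d) (b ℤ.* c)) (cong₂ ℚ._+_ (ι-* a d) (ι-* b c))) (ι-*₃ τ b d))
      rational₁ : ∀ a b c d τ ν θ →
        a ℚ.* c ℚ.+ ν ℚ.* (b ℚ.* d) ℚ.+ (a ℚ.* d ℚ.+ b ℚ.* c ℚ.+ τ ℚ.* (b ℚ.* d)) ℚ.* θ
        ≡ a ℚ.* c ℚ.+ (a ℚ.* d ℚ.+ b ℚ.* c) ℚ.* θ ℚ.+ b ℚ.* d ℚ.* (τ ℚ.* θ ℚ.+ ν)
      rational₁ = solve-∀ ringℚ
      rational₂ : ∀ a b c d D θ θ′ →
        a ℚ.* c ℚ.+ (a ℚ.* d ℚ.+ b ℚ.* c) ℚ.* θ ℚ.+ b ℚ.* d ℚ.* (θ ℚ.* θ ℚ.+ D ℚ.* (θ′ ℚ.* θ′))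
        ≡ (a ℚ.+ b ℚ.* θ) ℚ.* (c ℚ.+ d ℚ.* θ) ℚ.+ D ℚ.* (b ℚ.* θ′ ℚ.* (d ℚ.* θ′))
      rational₂ = solve-∀ ringℚ
      irrational₁ : ∀ a b c d τ θ → (a ℚ.* d ℚ.+ b ℚ.* c ℚ.+ τ ℚ.* (b ℚ.* d)) ℚ.* θ
                  ≡ (a ℚ.* d ℚ.+ b ℚ.* c) ℚ.* θ ℚ.+ b ℚ.* d ℚ.* (τ ℚ.* θ)
      irrational₁ = solve-∀ ringℚ
      irrational₂ : ∀ a b c d θ θ′ →
        (a ℚ.* d ℚ.+ b ℚ.* c) ℚ.* θ′ ℚ.+ b ℚ.* d ℚ.* (θ ℚ.* θ′ ℚ.+ θ′ ℚ.* θ)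
        ≡ (a ℚ.+ b ℚ.* θ) ℚ.* (d ℚ.* θ′) ℚ.+ b ℚ.* θ′ ℚ.* (c ℚ.+ d ℚ.* θ)
      irrational₂ = solve-∀ ringℚ

    embed-fromℤ : ∀ z → embed (z , 0ℤ) ≡ fromℤ z
    embed-fromℤ z = cong₂ _+√D_ (rational (ι z) θ₀) (ℚ.*-zeroˡ θ₁)
      where
      rational : ∀ z θ → z ℚ.+ 0ℚ ℚ.* θ ≡ z
      rational = solve-∀ ringℚ

    fromℤ-injective : ∀ y z → fromℤ y ≡ fromℤ z → y ≡ z
    fromℤ-injective y z eq = ι-injective y z (cong re eq)

    *-interchange : ∀ s x y → s * x * (s * y) ≡ s * s * (x * y)
    *-interchange s x y = begin
      s * x * (s * y)       ≡⟨ *-assoc s x (s * y) ⟩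
      s * (x * (s * y))     ≡⟨ cong (s *_) (*-comm x (s * y)) ⟩
      s * (s * y * x)       ≡⟨ cong (s *_) (*-assoc s y x) ⟩
      s * (s * (y * x))     ≡⟨ *-assoc s s (y * x) ⟨
      s * s * (y * x)       ≡⟨ cong (s * s *_) (*-comm y x) ⟩
      s * s * (x * y)       ∎
      where open ≡-Reasoning

    embed-square : ∀ σ → embed (σ ℤ.* σ , 0ℤ) ≡ fromℤ σ * fromℤ σ
    embed-square σ = begin
      embed (σ ℤ.* σ , 0ℤ)                       ≡⟨ cong embed (cong₂ _,_ (rational ν σ) (irrational τ σ)) ⟩
      embed ((σ , 0ℤ) ⊗ (σ , 0ℤ))                ≡⟨ embed-⊗ (σ , 0ℤ) (σ , 0ℤ) ⟩
      embed (σ , 0ℤ) * embed (σ , 0ℤ)            ≡⟨ cong₂ _*_ (embed-fromℤ σ) (embed-fromℤ σ) ⟩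
      fromℤ σ * fromℤ σ                          ∎
      where
      open ≡-Reasoning
      rational : ∀ ν σ → σ ℤ.* σ ≡ σ ℤ.* σ ℤ.+ ν ℤ.* (0ℤ ℤ.* 0ℤ)
      rational = solve-∀ ringℤ
      irrational : ∀ τ σ → 0ℤ ≡ σ ℤ.* 0ℤ ℤ.+ 0ℤ ℤ.* σ ℤ.+ τ ℤ.* (0ℤ ℤ.* 0ℤ)
      irrational = solve-∀ ringℤ

    -- The ideal is (p, κ₀ + θ), and σ is a common denominator carrying 𝒪 into ℤ[θ]. Generator and
    -- cofactors are each scaled by σ, so their products acquire σ², the `s` of `generator-norm`.
    principal⇒norm : ∀ {p} → Prime p → ∀ σ κ₀ e → p ∤ ∣ σ ℤ.* σ ∣ → norm′ (κ₀ , 1ℤ) ≡ + p ℤ.* e →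
      (∀ x → IsIntegral x → ∃₂ λ x′ n → fromℤ σ * x ≡ embed x′ × norm′ x′ ≡ σ ℤ.* σ ℤ.* n) →
      ∀ h → IsClassNumber D h → ¬ h ℕ.> 1 →
      ∃₂ λ x c → c ∣ ∣ σ ℤ.* σ ∣ × ∣ norm′ x ∣ ≡ c ℕ.* p
    principal⇒norm {p} pp σ κ₀ e p∤σ² Nκ≡ coordinates h hD h≯1 =
      let ξ , a , b , u , v , a∈𝒪 , b∈𝒪 , u∈𝒪 , v∈𝒪 , ξ≡ , g≡ , κ≡ =
            two-generated⇒principal h hD h≯1 (embed g′) (embed κ′) g≢0
          A , _ , A≡ , _ = coordinates a a∈𝒪
          B , _ , B≡ , _ = coordinates b b∈𝒪
          U , nu , U≡ , NU≡ = coordinates u u∈𝒪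
          V , _ , V≡ , _ = coordinates v v∈𝒪
          X = A ⊗ g′ ⊕ B ⊗ κ′
          X≡ = generator ξ a b A B ξ≡ A≡ B≡
      in X , generator-norm′ pp (σ ℤ.* σ) κ₀ e X A B U V nu p∤σ² Nκ≡ refl
           (cofactor ξ u X U g′ X≡ U≡ g≡) (cofactor ξ v X V κ′ X≡ V≡ κ≡) NU≡
      where
      open ≡-Reasoning
      g′ κ′ : ℤ × ℤ
      g′ = + p , 0ℤ
      κ′ = κ₀ , 1ℤ
      g≢0 : embed g′ ≢ 0K
      g≢0 eq = ℕ.≢-nonZero⁻¹ p {{prime⇒nonZero pp}}
        (cong ∣_∣ (fromℤ-injective (+ p) 0ℤ (trans (sym (embed-fromℤ (+ p))) eq)))
      generator : ∀ ξ a b A B → ξ ≡ a * embed g′ + b * embed κ′ → fromℤ σ * a ≡ embed A → fromℤ σ * b ≡ embed B →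
                  fromℤ σ * ξ ≡ embed (A ⊗ g′ ⊕ B ⊗ κ′)
      generator ξ a b A B ξ≡ A≡ B≡ = begin
        fromℤ σ * ξ                                              ≡⟨ cong (fromℤ σ *_) ξ≡ ⟩
        fromℤ σ * (a * embed g′ + b * embed κ′)                  ≡⟨ *-distribˡ-+ (fromℤ σ) (a * embed g′) (b * embed κ′) ⟩
        fromℤ σ * (a * embed g′) + fromℤ σ * (b * embed κ′)      ≡⟨ cong₂ _+_ (*-assoc (fromℤ σ) a (embed g′)) (*-assoc (fromℤ σ) b (embed κ′)) ⟨
        fromℤ σ * a * embed g′ + fromℤ σ * b * embed κ′          ≡⟨ cong₂ (λ s t → s * embed g′ + t * embed κ′) A≡ B≡ ⟩
        embed A * embed g′ + embed B * embed κ′                  ≡⟨ cong₂ _+_ (embed-⊗ A g′) (embed-⊗ B κ′) ⟨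
        embed (A ⊗ g′) + embed (B ⊗ κ′)                          ≡⟨ embed-⊕ (A ⊗ g′) (B ⊗ κ′) ⟨
        embed (A ⊗ g′ ⊕ B ⊗ κ′)                                  ∎
      cofactor : ∀ ξ u X U y → fromℤ σ * ξ ≡ embed X → fromℤ σ * u ≡ embed U → embed y ≡ ξ * u →
                 X ⊗ U ≡ (σ ℤ.* σ , 0ℤ) ⊗ y
      cofactor ξ u X U y X≡ U≡ y≡ = embed-injective (X ⊗ U) ((σ ℤ.* σ , 0ℤ) ⊗ y) (begin
        embed (X ⊗ U)                                ≡⟨ embed-⊗ X U ⟩
        embed X * embed U                            ≡⟨ cong₂ _*_ X≡ U≡ ⟨
        fromℤ σ * ξ * (fromℤ σ * u)                  ≡⟨ *-interchange (fromℤ σ) ξ u ⟩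
        fromℤ σ * fromℤ σ * (ξ * u)                  ≡⟨ cong₂ _*_ (embed-square σ) y≡ ⟨
        embed (σ ℤ.* σ , 0ℤ) * embed y               ≡⟨ embed-⊗ (σ ℤ.* σ , 0ℤ) y ⟨
        embed ((σ ℤ.* σ , 0ℤ) ⊗ y)                   ∎)

-- Choice of the prime

∣m⊖n∣≡∣m-n∣ : ∀ m n → ∣ m ℤ.⊖ n ∣ ≡ ℕ.∣ m - n ∣
∣m⊖n∣≡∣m-n∣ zero    zero    = refl
∣m⊖n∣≡∣m-n∣ zero    (suc n) = refl
∣m⊖n∣≡∣m-n∣ (suc m) zero    = refl
∣m⊖n∣≡∣m-n∣ (suc m) (suc n) = trans (cong ∣_∣ (ℤ.[1+m]⊖[1+n]≡m⊖n m n)) (∣m⊖n∣≡∣m-n∣ m n)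

i*i≡∣i∣*∣i∣ : ∀ i → i ℤ.* i ≡ + (∣ i ∣ ℕ.* ∣ i ∣)
i*i≡∣i∣*∣i∣ (+ n)    = sym (ℤ.pos-* n n)
i*i≡∣i∣*∣i∣ -[1+ n ] = refl

abs-norm : ∀ D x y → ∣ x ℤ.* x ℤ.- + D ℤ.* (y ℤ.* y) ∣ ≡ ℕ.∣ ∣ x ∣ ℕ.* ∣ x ∣ - D ℕ.* (∣ y ∣ ℕ.* ∣ y ∣) ∣
abs-norm D x y = begin
  ∣ x ℤ.* x ℤ.- + D ℤ.* (y ℤ.* y) ∣          ≡⟨ cong₂ (λ s t → ∣ s ℤ.- + D ℤ.* t ∣) (i*i≡∣i∣*∣i∣ x) (i*i≡∣i∣*∣i∣ y) ⟩
  ∣ + x² ℤ.- + D ℤ.* + y² ∣                  ≡⟨ cong (λ t → ∣ + x² ℤ.- t ∣) (ℤ.pos-* D y²) ⟨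
  ∣ + x² ℤ.- + (D ℕ.* y²) ∣                  ≡⟨ cong ∣_∣ (ℤ.m-n≡m⊖n x² (D ℕ.* y²)) ⟩
  ∣ x² ℤ.⊖ (D ℕ.* y²) ∣                      ≡⟨ ∣m⊖n∣≡∣m-n∣ x² (D ℕ.* y²) ⟩
  ℕ.∣ x² - D ℕ.* y² ∣                        ∎
  where
  open ≡-Reasoning
  x² = ∣ x ∣ ℕ.* ∣ x ∣
  y² = ∣ y ∣ ℕ.* ∣ y ∣

-- The even case asks for 4 because a gcd of 2 may leave D ≡ 5 modulo 8, with 2 inert: so it is for
-- b = 2, s = 4. Among the prime factors, either an odd one occurs in the first two places or both
-- are 2.
oddPrime⊎4∣ : ∀ g → g ℕ.> 2 → (∃[ p ] Prime p × p ≢ 2 × p ∣ g) ⊎ 4 ∣ g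
oddPrime⊎4∣ g g>2 = search (PrimeFactorisation.factors f) (PrimeFactorisation.isFactorisation f)
                           (PrimeFactorisation.factorsPrime f)
  where
  f = factorise g {{ℕ.>-nonZero (ℕ.≤-trans (s≤s z≤n) g>2)}}
  search : ∀ ps → g ≡ product ps → All Prime ps → (∃[ p ] Prime p × p ≢ 2 × p ∣ g) ⊎ 4 ∣ g
  search [] g≡1 _ = ⊥-elim (ℕ.<⇒≱ g>2 (ℕ.≤-trans (ℕ.≤-reflexive g≡1) (s≤s z≤n)))
  search (p ∷ ps) g≡ (pp ∷ _) with p ℕ.≟ 2
  ... | no p≢2 = inj₁ (p , pp , p≢2 , divides (product ps) (trans g≡ (ℕ.*-comm p (product ps))))
  search (p ∷ []) g≡ _ | yes refl = ⊥-elim (ℕ.<⇒≱ g>2 (ℕ.≤-reflexive g≡))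
  search (p ∷ r ∷ ps) g≡ (_ ∷ pr ∷ _) | yes refl with r ℕ.≟ 2
  ... | no r≢2   = inj₁ (r , pr , r≢2 , divides (2 ℕ.* product ps) (trans g≡ (identity r (product ps))))
    where
    identity : ∀ r t → 2 ℕ.* (r ℕ.* t) ≡ 2 ℕ.* t ℕ.* r
    identity = ℕ-Solver.solve-∀
  ... | yes refl = inj₂ (divides (product ps) (trans g≡ (identity (product ps))))
    where
    identity : ∀ t → 2 ℕ.* (2 ℕ.* t) ≡ t ℕ.* 4
    identity = ℕ-Solver.solve-∀

oddPrime∤4 : ∀ {p} → Prime p → p ≢ 2 → p ∤ 4
oddPrime∤4 {p} pp p≢2 p∣4 = ∤2 (prime∤⇒∣-cancelˡ {m = 2} {2} pp ∤2 p∣4)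
  where
  ∤2 : p ∤ 2
  ∤2 p∣2 with prime⇒irreducible prime[2] p∣2
  ... | inj₁ refl = ¬prime[1] pp
  ... | inj₂ p≡2  = p≢2 p≡2

-- Otherwise p divides z, so p² divides cp and p divides c.
nonsquare-prime-multiple : ∀ {p} → Prime p → ∀ c → p ∤ c → ∀ z → z ℕ.* z ≢ c ℕ.* p
nonsquare-prime-multiple {p} pp c p∤c z z²≡cp with reduce (euclidsLemma z z pp (divides c z²≡cp))
... | divides y refl = p∤c (divides (y ℕ.* y) (sym (ℕ.*-cancelʳ-≡ (y ℕ.* y ℕ.* p) c p {{prime⇒nonZero pp}}
      (trans (identity y p) z²≡cp))))
  where
  identity : ∀ y p → y ℕ.* y ℕ.* p ℕ.* p ≡ y ℕ.* p ℕ.* (y ℕ.* p)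
  identity = ℕ-Solver.solve-∀

nonsquare-8 : ∀ z → z ℕ.* z ≢ 8
nonsquare-8 0 ()
nonsquare-8 1 ()
nonsquare-8 2 ()
nonsquare-8 z@(suc (suc (suc _))) z²≡8 = ℕ.<⇒≱ {8} {9} ℕ.≤-refl
  (ℕ.≤-trans (ℕ.*-mono-≤ {3} {z} {3} {z} (s≤s (s≤s (s≤s z≤n))) (s≤s (s≤s (s≤s z≤n)))) (ℕ.≤-reflexive z²≡8))

pow-≡1 : ∀ M r k → ∃[ f ] (M ℕ.* r ℕ.+ 1) ℕ.^ k ≡ 1 ℕ.+ M ℕ.* f
pow-≡1 M r zero    = 0 , sym (cong suc (ℕ.*-zeroʳ M))
pow-≡1 M r (suc k) =
  let f , eq = pow-≡1 M r k
  in _ , trans (cong ((M ℕ.* r ℕ.+ 1) ℕ.*_) eq) (identity M r f)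
  where
  identity : ∀ M r f → (M ℕ.* r ℕ.+ 1) ℕ.* (1 ℕ.+ M ℕ.* f) ≡ 1 ℕ.+ M ℕ.* (r ℕ.+ f ℕ.+ M ℕ.* r ℕ.* f)
  identity = ℕ-Solver.solve-∀

-- Since g² divides bs, both q and its powers are 1 modulo g², while m is a multiple of g.
discriminant≡1 : ∀ g b s k → g ∣ b → g ∣ s → let q = 4 ℕ.* b ℕ.* s ℕ.+ 1; m = b ℕ.* q ℕ.^ k ℕ.+ s in
      ∃[ e ] q ℕ.^ k ℕ.+ m ℕ.* m ≡ 1 ℕ.+ g ℕ.* g ℕ.* e
discriminant≡1 g b s k (divides β refl) (divides γ refl) =
  let f , eq = pow-≡1 (g ℕ.* g) (4 ℕ.* β ℕ.* γ) k
  in _ , trans (cong (λ Q → Q ℕ.+ (β ℕ.* g ℕ.* Q ℕ.+ γ ℕ.* g) ℕ.* (β ℕ.* g ℕ.* Q ℕ.+ γ ℕ.* g))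
           (trans (cong (λ t → (t ℕ.+ 1) ℕ.^ k) (regroup g β γ)) eq))
         (identity g (1 ℕ.+ g ℕ.* g ℕ.* f) f β γ)
  where
  regroup : ∀ g β γ → 4 ℕ.* (β ℕ.* g) ℕ.* (γ ℕ.* g) ≡ g ℕ.* g ℕ.* (4 ℕ.* β ℕ.* γ)
  regroup = ℕ-Solver.solve-∀
  identity : ∀ g Q f β γ → 1 ℕ.+ g ℕ.* g ℕ.* f ℕ.+ (β ℕ.* g ℕ.* Q ℕ.+ γ ℕ.* g) ℕ.* (β ℕ.* g ℕ.* Q ℕ.+ γ ℕ.* g)
           ≡ 1 ℕ.+ g ℕ.* g ℕ.* (f ℕ.+ (β ℕ.* Q ℕ.+ γ) ℕ.* (β ℕ.* Q ℕ.+ γ))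
  identity = ℕ-Solver.solve-∀

-- Norm equations forced by class number one

module _ (D : ℕ) (sf : Squarefree D) where
  open Field D hiding (IsClassNumber)
  open ClassNumber D

  -- The order is ℤ[√D] with σ = 2, which is prime to p, so D need not be split by its residue
  -- modulo 4. The element κ = 1 + √D has norm 1 - D = -pe.
  principal⇒norm-odd : ∀ {p} → Prime p → p ≢ 2 → ∀ e → D ≡ 1 ℕ.+ p ℕ.* e →
    ∀ h → IsClassNumber D h → ¬ h ℕ.> 1 →
    ∃₂ λ x y → ∃[ c ] c ∣ 4 × ∣ x ℤ.* x ℤ.- + D ℤ.* (y ℤ.* y) ∣ ≡ c ℕ.* p
  principal⇒norm-odd {p} pp p≢2 e D≡ h hD h≯1 =
    let (x , y) , c , c∣4 , eq = principal⇒norm pp (+ 2) 1ℤ (ℤ.- + e) (oddPrime∤4 pp p≢2) norm-κ coordinates h hD h≯1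
    in x , y , c , c∣4 , trans (cong ∣_∣ (sym (norm≡ (+ D) x y))) eq
    where
    re-identity : ∀ D → 0ℚ ℚ.* 0ℚ ℚ.+ D ℚ.* (1ℚ ℚ.* 1ℚ) ≡ ι 0ℤ ℚ.* 0ℚ ℚ.+ D
    re-identity = solve-∀ ringℚ
    open Order 0ℤ (+ D) 0ℚ 1ℚ 1ℚ refl (re-identity Dℚ) refl
    norm≡ : ∀ D x y → x ℤ.* x ℤ.+ 0ℤ ℤ.* (x ℤ.* y) ℤ.- D ℤ.* (y ℤ.* y) ≡ x ℤ.* x ℤ.- D ℤ.* (y ℤ.* y)
    norm≡ = solve-∀ ringℤ
    norm-κ : norm′ (1ℤ , 1ℤ) ≡ + p ℤ.* (ℤ.- + e)
    norm-κ = trans (cong (λ D → 1ℤ ℤ.* 1ℤ ℤ.+ 0ℤ ℤ.* (1ℤ ℤ.* 1ℤ) ℤ.- D ℤ.* (1ℤ ℤ.* 1ℤ))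
        (trans (cong +_ D≡) (cong (λ t → 1ℤ ℤ.+ t) (ℤ.pos-* p e)))) (identity (+ p) (+ e))
      where
      identity : ∀ p e → 1ℤ ℤ.* 1ℤ ℤ.+ 0ℤ ℤ.* (1ℤ ℤ.* 1ℤ) ℤ.- (1ℤ ℤ.+ p ℤ.* e) ℤ.* (1ℤ ℤ.* 1ℤ) ≡ p ℤ.* (ℤ.- e)
      identity = solve-∀ ringℤ
    coordinates : ∀ x → IsIntegral x → ∃₂ λ x′ n → fromℤ (+ 2) * x ≡ embed x′ × norm′ x′ ≡ + 2 ℤ.* + 2 ℤ.* n
    coordinates x x∈𝒪 =
      let t , w , n , t≡ , w≡ , n≡ = integral⇒half-integral sf x x∈𝒪
      in (t , w) , n ,
         trans (fromℤ-* (+ 2) x) (cong₂ _+√D_ (trans t≡ (re≡ (ι t) (ι w))) (trans w≡ (sym (ℚ.*-identityʳ (ι w))))) ,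
         trans (norm≡ (+ D) t w) n≡
      where
      re≡ : ∀ t w → t ≡ t ℚ.+ w ℚ.* 0ℚ
      re≡ = solve-∀ ringℚ

  -- A common denominator 2 is ruled out by p = 2, so σ = 1 and θ = (1 + √D)/2, with ν = (D - 1)/4 =
  -- 4e. The element κ = θ has the even norm -4e, and a norm ±2 becomes ±8 after multiplication by
  -- 4.
  principal⇒norm-even : ∀ e → D ≡ 1 ℕ.+ 16 ℕ.* e → ∀ h → IsClassNumber D h → ¬ h ℕ.> 1 →
    ∃₂ λ x y → ∣ x ℤ.* x ℤ.- + D ℤ.* (y ℤ.* y) ∣ ≡ 8
  principal⇒norm-even e D≡ h hD h≯1 =
    completed (principal⇒norm prime[2] 1ℤ 0ℤ (+ 2 ℤ.* (ℤ.- + e)) (λ 2∣1 → 2≢1 (∣.∣1⇒≡1 2∣1))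
                 norm-κ coordinates h hD h≯1)
    where
    open ≡-Reasoning
    ν = + 4 ℤ.* + e
    2≢1 : 2 ≢ 1
    2≢1 ()
    +D≡ : + D ≡ 1ℤ ℤ.+ + 4 ℤ.* ν
    +D≡ = trans (cong +_ D≡) (trans (cong (λ t → 1ℤ ℤ.+ t) (ℤ.pos-* 16 e)) (identity (+ e)))
      where
      identity : ∀ e → 1ℤ ℤ.+ + 16 ℤ.* e ≡ 1ℤ ℤ.+ + 4 ℤ.* (+ 4 ℤ.* e)
      identity = solve-∀ ringℤ
    Dℚ≡ : Dℚ ≡ ι 1ℤ ℚ.+ ι (+ 4) ℚ.* ι ν
    Dℚ≡ = trans (cong ι +D≡) (trans (ι-+ 1ℤ (+ 4 ℤ.* ν)) (cong (λ t → ι 1ℤ ℚ.+ t) (ι-* (+ 4) ν)))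
    re-identity : ½ ℚ.* ½ ℚ.+ Dℚ ℚ.* (½ ℚ.* ½) ≡ ι 1ℤ ℚ.* ½ ℚ.+ ι ν
    re-identity = trans (cong (λ D → ½ ℚ.* ½ ℚ.+ D ℚ.* (½ ℚ.* ½)) Dℚ≡) (identity (ι ν))
      where
      identity : ∀ ν → ½ ℚ.* ½ ℚ.+ (ι 1ℤ ℚ.+ ι (+ 4) ℚ.* ν) ℚ.* (½ ℚ.* ½) ≡ ι 1ℤ ℚ.* ½ ℚ.+ ν
      identity = solve-∀ ringℚ
    open Order 1ℤ ν ½ ½ (ι (+ 2)) refl re-identity refl
    norm≡ : ∀ x y → (+ 2 ℤ.* x ℤ.+ y) ℤ.* (+ 2 ℤ.* x ℤ.+ y) ℤ.- + D ℤ.* (y ℤ.* y) ≡ + 4 ℤ.* norm′ (x , y)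
    norm≡ x y = trans (cong (λ D → (+ 2 ℤ.* x ℤ.+ y) ℤ.* (+ 2 ℤ.* x ℤ.+ y) ℤ.- D ℤ.* (y ℤ.* y)) +D≡) (identity ν x y)
      where
      identity : ∀ ν x y → (+ 2 ℤ.* x ℤ.+ y) ℤ.* (+ 2 ℤ.* x ℤ.+ y) ℤ.- (1ℤ ℤ.+ + 4 ℤ.* ν) ℤ.* (y ℤ.* y)
               ≡ + 4 ℤ.* (x ℤ.* x ℤ.+ 1ℤ ℤ.* (x ℤ.* y) ℤ.- ν ℤ.* (y ℤ.* y))
      identity = solve-∀ ringℤ
    norm-κ : norm′ (0ℤ , 1ℤ) ≡ + 2 ℤ.* (+ 2 ℤ.* (ℤ.- + e))
    norm-κ = identity (+ e)
      where
      identity : ∀ e → 0ℤ ℤ.* 0ℤ ℤ.+ 1ℤ ℤ.* (0ℤ ℤ.* 1ℤ) ℤ.- + 4 ℤ.* e ℤ.* (1ℤ ℤ.* 1ℤ) ≡ + 2 ℤ.* (+ 2 ℤ.* (ℤ.- e))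
      identity = solve-∀ ringℤ
    completed : (∃₂ λ x c → c ∣ 1 × ∣ norm′ x ∣ ≡ c ℕ.* 2) →
                ∃₂ λ x y → ∣ x ℤ.* x ℤ.- + D ℤ.* (y ℤ.* y) ∣ ≡ 8
    completed ((x , y) , c , c∣1 , Nx≡) = + 2 ℤ.* x ℤ.+ y , y , (begin
      ∣ (+ 2 ℤ.* x ℤ.+ y) ℤ.* (+ 2 ℤ.* x ℤ.+ y) ℤ.- + D ℤ.* (y ℤ.* y) ∣   ≡⟨ cong ∣_∣ (norm≡ x y) ⟩
      ∣ + 4 ℤ.* norm′ (x , y) ∣                                          ≡⟨ ℤ.abs-* (+ 4) (norm′ (x , y)) ⟩
      4 ℕ.* ∣ norm′ (x , y) ∣                                            ≡⟨ cong (4 ℕ.*_) Nx≡ ⟩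
      4 ℕ.* (c ℕ.* 2)                                                    ≡⟨ cong (λ c → 4 ℕ.* (c ℕ.* 2)) (∣.∣1⇒≡1 c∣1) ⟩
      8                                                                  ∎)

    -- t² − Dw² = 4n forces (t − w)(t + w) to be even, and t + w = (t − w) + 2w.
    t-w-even : ∀ t w n → t ℤ.* t ℤ.- + D ℤ.* (w ℤ.* w) ≡ + 4 ℤ.* n → ∃[ a ] t ≡ + 2 ℤ.* a ℤ.+ w
    t-w-even t w n n≡ = split (euclidsLemma ∣ t ℤ.- w ∣ ∣ t ℤ.+ w ∣ prime[2]
        (divides (∣ n ℤ.+ ν ℤ.* (w ℤ.* w) ∣ ℕ.* 2) (begin
      ∣ t ℤ.- w ∣ ℕ.* ∣ t ℤ.+ w ∣                       ≡⟨ ℤ.abs-* (t ℤ.- w) (t ℤ.+ w) ⟨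
      ∣ (t ℤ.- w) ℤ.* (t ℤ.+ w) ∣                       ≡⟨ cong ∣_∣ factored ⟩
      ∣ (n ℤ.+ ν ℤ.* (w ℤ.* w)) ℤ.* + 4 ∣               ≡⟨ ℤ.abs-* (n ℤ.+ ν ℤ.* (w ℤ.* w)) (+ 4) ⟩
      ∣ n ℤ.+ ν ℤ.* (w ℤ.* w) ∣ ℕ.* (2 ℕ.* 2)           ≡⟨ ℕ.*-assoc ∣ n ℤ.+ ν ℤ.* (w ℤ.* w) ∣ 2 2 ⟨
      ∣ n ℤ.+ ν ℤ.* (w ℤ.* w) ∣ ℕ.* 2 ℕ.* 2             ∎)))
      where
      factor : ∀ ν t w → (t ℤ.- w) ℤ.* (t ℤ.+ w)
             ≡ t ℤ.* t ℤ.- (1ℤ ℤ.+ + 4 ℤ.* ν) ℤ.* (w ℤ.* w) ℤ.+ + 4 ℤ.* (ν ℤ.* (w ℤ.* w))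
      factor = solve-∀ ringℤ
      collect : ∀ n m → + 4 ℤ.* n ℤ.+ + 4 ℤ.* m ≡ (n ℤ.+ m) ℤ.* + 4
      collect = solve-∀ ringℤ
      factored : (t ℤ.- w) ℤ.* (t ℤ.+ w) ≡ (n ℤ.+ ν ℤ.* (w ℤ.* w)) ℤ.* + 4
      factored = begin
        (t ℤ.- w) ℤ.* (t ℤ.+ w)
          ≡⟨ factor ν t w ⟩
        t ℤ.* t ℤ.- (1ℤ ℤ.+ + 4 ℤ.* ν) ℤ.* (w ℤ.* w) ℤ.+ + 4 ℤ.* (ν ℤ.* (w ℤ.* w))
          ≡⟨ cong (λ D → t ℤ.* t ℤ.- D ℤ.* (w ℤ.* w) ℤ.+ + 4 ℤ.* (ν ℤ.* (w ℤ.* w))) +D≡ ⟨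
        t ℤ.* t ℤ.- + D ℤ.* (w ℤ.* w) ℤ.+ + 4 ℤ.* (ν ℤ.* (w ℤ.* w))
          ≡⟨ cong (λ t → t ℤ.+ + 4 ℤ.* (ν ℤ.* (w ℤ.* w))) n≡ ⟩
        + 4 ℤ.* n ℤ.+ + 4 ℤ.* (ν ℤ.* (w ℤ.* w))
          ≡⟨ collect n (ν ℤ.* (w ℤ.* w)) ⟩
        (n ℤ.+ ν ℤ.* (w ℤ.* w)) ℤ.* + 4 ∎
      from-difference : ∀ t w → t ≡ t ℤ.- w ℤ.+ w
      from-difference = solve-∀ ringℤ
      from-sum : ∀ t w → t ≡ t ℤ.+ w ℤ.- w
      from-sum = solve-∀ ringℤ
      regroup⁻ : ∀ a w → a ℤ.* + 2 ℤ.+ w ≡ + 2 ℤ.* a ℤ.+ w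
      regroup⁻ = solve-∀ ringℤ
      regroup⁺ : ∀ a w → a ℤ.* + 2 ℤ.- w ≡ + 2 ℤ.* (a ℤ.- w) ℤ.+ w
      regroup⁺ = solve-∀ ringℤ
      split : (2 ∣ ∣ t ℤ.- w ∣) ⊎ (2 ∣ ∣ t ℤ.+ w ∣) → ∃[ a ] t ≡ + 2 ℤ.* a ℤ.+ w
      split (inj₁ 2∣t-w) =
        let Signed.divides a t-w≡ = Signed.∣ᵤ⇒∣ {+ 2} {t ℤ.- w} 2∣t-w
        in a , trans (from-difference t w) (trans (cong (λ d → d ℤ.+ w) t-w≡) (regroup⁻ a w))
      split (inj₂ 2∣t+w) =
        let Signed.divides a t+w≡ = Signed.∣ᵤ⇒∣ {+ 2} {t ℤ.+ w} 2∣t+w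
        in a ℤ.- w , trans (from-sum t w) (trans (cong (λ d → d ℤ.- w) t+w≡) (regroup⁺ a w))

    coordinates : ∀ x → IsIntegral x → ∃₂ λ x′ n → fromℤ 1ℤ * x ≡ embed x′ × norm′ x′ ≡ 1ℤ ℤ.* 1ℤ ℤ.* n
    coordinates x x∈𝒪 =
      let t , w , n , t≡ , w≡ , n≡ = integral⇒half-integral sf x x∈𝒪
          a , t≡2a+w = t-w-even t w n n≡
      -- With t = 2a + w, the element (t + w√D)/2 is a + wθ.
      in (a , w) , n ,
         trans (*-identityˡ x) (cong₂ _+√D_
           (halve (re x) (ι a ℚ.+ ι w ℚ.* ½) (trans t≡ (trans (cong ι t≡2a+w) (ι-2a+w a w))))
           (halve (im x) (ι w ℚ.* ½) (trans w≡ (double (ι w))))) ,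
         trans (ℤ.*-cancelˡ-≡ (+ 4) (norm′ (a , w)) n (trans (sym (norm≡ a w)) (trans
           (cong (λ t → t ℤ.* t ℤ.- + D ℤ.* (w ℤ.* w)) (sym t≡2a+w)) n≡))) (sym (ℤ.*-identityˡ n))
      where
      cancel-2 : ∀ u → u ≡ ½ ℚ.* (ι (+ 2) ℚ.* u)
      cancel-2 = solve-∀ ringℚ
      halve : ∀ u v → ι (+ 2) ℚ.* u ≡ ι (+ 2) ℚ.* v → u ≡ v
      halve u v eq = trans (cancel-2 u) (trans (cong (½ ℚ.*_) eq) (sym (cancel-2 v)))
      double : ∀ w → w ≡ ι (+ 2) ℚ.* (w ℚ.* ½)
      double = solve-∀ ringℚ
      ι-2a+w : ∀ a w → ι (+ 2 ℤ.* a ℤ.+ w) ≡ ι (+ 2) ℚ.* (ι a ℚ.+ ι w ℚ.* ½)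
      ι-2a+w a w = trans (ι-+ (+ 2 ℤ.* a) w) (trans (cong (ℚ._+ ι w) (ι-* (+ 2) a)) (identity (ι a) (ι w)))
        where
        identity : ∀ a w → ι (+ 2) ℚ.* a ℚ.+ w ≡ ι (+ 2) ℚ.* (a ℚ.+ w ℚ.* ½)
        identity = solve-∀ ringℚ

-- Size estimates and the contradiction

open import Data.Nat.Base using (_+_; _*_; _^_; _>_)

module _ (b s k : ℕ) (b>0 : b > 0) (s>0 : s > 0) (k>0 : k > 0) where
  private
    q = 4 * b * s + 1
    m = b * q ^ k + s

  norm-nonrep : ∀ N → N ℕ.< q → (∀ z → z * z ≢ N) →
                ∀ x y → ∣ x ℤ.* x ℤ.- + (q ^ k + m * m) ℤ.* (y ℤ.* y) ∣ ≢ N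
  norm-nonrep N N<q nonsquare x y eq =
    Reduction.Descent.pell-nonrep b s q m k N refl refl (ℕ.<-≤-trans s>0 (ℕ.m≤n+m s (b * q ^ k))) N<q
      (ℕ.<-≤-trans N<q q≤q^k) nonsquare ∣ x ∣ ∣ y ∣ (trans (sym (abs-norm (q ^ k + m * m) x y)) eq)
    where
    q≤q^k : q ℕ.≤ q ^ k
    q≤q^k = ℕ.≤-trans (ℕ.≤-reflexive (sym (ℕ.^-identityʳ q)))
      (ℕ.^-monoʳ-≤ q {{ℕ.>-nonZero (ℕ.m≤n+m 1 (4 * b * s))}} k>0)

  4*<q : ∀ n → n ∣ b → 4 * n ℕ.< q
  4*<q n n∣b = begin-strict
    4 * n            ≤⟨ ℕ.*-monoʳ-≤ 4 (∣.∣⇒≤ {{ℕ.>-nonZero b>0}} n∣b) ⟩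
    4 * b            ≤⟨ ℕ.m≤m*n (4 * b) s {{ℕ.>-nonZero s>0}} ⟩
    4 * b * s        <⟨ ℕ.m<m+n (4 * b * s) (s≤s z≤n) ⟩
    q                ∎
    where open ℕ.≤-Reasoning

  classNumber≯1⇒⊥ : ∀ D → D ≡ q ^ k + m * m → Squarefree D → gcd b s > 2 →
                   ∀ h → IsClassNumber D h → ¬ h > 1 → ⊥
  classNumber≯1⇒⊥ D refl sf gcd>2 h hD h≯1 = split (oddPrime⊎4∣ (gcd b s) gcd>2)
    where
    split : (∃[ p ] Prime p × p ≢ 2 × p ∣ gcd b s) ⊎ 4 ∣ gcd b s → ⊥
    split (inj₁ (p , pp , p≢2 , p∣gcd)) =
      let p∣b = ∣.∣-trans p∣gcd (gcd[m,n]∣m b s)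
          e , D≡1+ppe = discriminant≡1 p b s k p∣b (∣.∣-trans p∣gcd (gcd[m,n]∣n b s))
          x , y , c , c∣4 , Nx≡ = principal⇒norm-odd D sf pp p≢2 (p * e)
                                    (trans D≡1+ppe (cong suc (ℕ.*-assoc p p e))) h hD h≯1
      -- The size bound is cp ≤ 4p < q, and an odd prime divides no divisor c of 4.
      in norm-nonrep (c * p) (ℕ.≤-<-trans (ℕ.*-monoˡ-≤ p (∣.∣⇒≤ c∣4)) (4*<q p p∣b))
           (nonsquare-prime-multiple pp c (λ p∣c → oddPrime∤4 pp p≢2 (∣.∣-trans p∣c c∣4))) x y Nx≡
    split (inj₂ 4∣gcd) =
      let 4∣b = ∣.∣-trans 4∣gcd (gcd[m,n]∣m b s)
          e , D≡1+16e = discriminant≡1 4 b s k 4∣b (∣.∣-trans 4∣gcd (gcd[m,n]∣n b s))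
          x , y , Nx≡ = principal⇒norm-even D sf e D≡1+16e h hD h≯1
      -- The bound is 8 < 8 + 8 = 4 · 4 < q.
      in norm-nonrep 8 (ℕ.<-trans (ℕ.m<m+n 8 {8} (s≤s z≤n)) (4*<q 4 4∣b)) nonsquare-8 x y Nx≡

proposition1p3 : ∀ (b s k : ℕ) → b > 0 → s > 0 → k > 0 →
    let D = (4 * b * s + 1) ^ k + (b * (4 * b * s + 1) ^ k + s) ^ 2 in
    Squarefree D →
    gcd b s > 2 →
    ∀ (h : ℕ) → IsClassNumber D h → h > 1
proposition1p3 b s k b>0 s>0 k>0 sf gcd>2 h hD = decidable-stable (1 ℕ.<? h)
  -- `m ^ 2` unfolds to `m * (m * 1)`, whereas the descent is stated with `m * m`.
  (classNumber≯1⇒⊥ b s k b>0 s>0 k>0 D (cong (λ t → Q + m * t) (ℕ.*-identityʳ m)) sf gcd>2 h hD)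
  where
  Q = (4 * b * s + 1) ^ k
  m = b * Q + s
  D = Q + m ^ 2
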